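{- Let $k$ be a positive integer, let $p\in(0,1]$, and let $\mathcal{A}$ be a monotone family of subsets of $[n]$ with minterms of size at most $k$ which is tame with respect to $p$. Then $$\mu_p(\mathcal{A})\ \ge\ \frac{\min\{\mathbb{E}_p[X^{\mathcal{A}}],\,1\}}{k2^k}.$$
   Context: Let $[n]=\{0,1,\ldots,n\}$. For $p\in[0,1]$, $[n]_p$ is a random subset of $[n]$ containing each element independently with probability $p$, and $\mu_p(\mathcal{A})=\Pr([n]_p\in\mathcal{A})$. A family $\mathcal{A}$ is monotone if $A\in\mathcal{A}$ and $A\subset B\subseteq [n]$ imply $B\in\mathcal{A}$. Minterms of $\mathcal{A}$ are its inclusion-minimal members; $\mathcal{M}(\mathcal{A})$ is the set of minterms. $X^{\mathcal{A}}$ is the random variable counting the minterms of $\mathcal{A}$ contained in $[n]_p$, and $\mathbb{E}_p[X^{\mathcal{A}}]=\sum_{M\in\mathcal{M}(\mathcal{A})}p^{|M|}$ is its expectation. For $V\subset[n]$ (possibly empty) and $m\ge1$, the family of $m$-supplements of $V$ with respect to $\mathcal{A}$ is $$N^m_{\mathcal{A}}(V)=\{W\subset[n] : |W|=m,\ W\cap V=\varnothing,\ W\cup V\in\mathcal{M}(\mathcal{A})\}.$$ A monotone family $\mathcal{A}$ with minterms of size at most $k$ is tame with respect to $p$ if for every $1\le m\le k-1$ and every $V\subset[n]$ one has $|N^m_{\mathcal{A}}(V)|<p^{ -m}$. -}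

module Defs where

open import Data.Bool using (Bool; T; T?)
open import Data.Fin.Subset using (Subset; inside; outside; _⊆_; _⊂_; _∩_; _∪_; ∣_∣; ⊥)
open import Data.Fin.Subset.Properties using (_⊆?_; _⊂?_; anySubset?)
open import Data.Integer using (+_)
open import Data.List using (List; []; _∷_; map; _++_; filter; length; foldr)
open import Data.Nat as ℕ using (ℕ; zero; suc; NonZero)
import Data.Nat.Properties as ℕ
open import Data.Product using (∃-syntax; _×_; _,_)
open import Data.Rational as ℚ using (ℚ; 0ℚ; 1ℚ; ½)
import Data.Rational.Properties as ℚ
open import Data.Rational.Solver using (module +-*-Solver)
open import Data.Sum using (inj₁; inj₂)
open import Data.Vec using ([]; _∷_)
open import Data.Vec.Properties using (≡-dec)
import Data.Bool.Properties as Bool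
open import Relation.Binary.PropositionalEquality using (_≡_; refl; sym; trans; cong; cong₂; subst)
open import Relation.Nullary using (yes; no; ¬_; contradiction; ¬?)
open import Relation.Nullary.Decidable using (map′; _×-dec_)
open import Level using (0ℓ)
open import Relation.Unary using (Pred; Decidable)

------------------------------------------------------------------------
-- Real numbers as Cauchy sequences of rationals. All operations act
-- termwise. Equality of reals is never needed, only _≤_ and _<_, both of
-- which respect the usual equivalence of Cauchy sequences.

IsCauchy : (ℕ → ℚ) → Set
IsCauchy x = ∀ ε → 0ℚ ℚ.< ε →
  ∃[ N ] (∀ m n → N ℕ.≤ m → N ℕ.≤ n → ℚ.∣ x m ℚ.- x n ∣ ℚ.< ε)

record ℝ : Set where
  constructor mkℝ
  field
    seq    : ℕ → ℚ
    cauchy : IsCauchy seq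

open ℝ public

infix 4 _≤_ _<_

_≤_ : ℝ → ℝ → Set
x ≤ y = ∀ ε → 0ℚ ℚ.< ε → ∃[ N ] (∀ n → N ℕ.≤ n → seq x n ℚ.≤ seq y n ℚ.+ ε)

_<_ : ℝ → ℝ → Set
x < y = ∃[ ε ] (0ℚ ℚ.< ε × ∃[ N ] (∀ n → N ℕ.≤ n → seq x n ℚ.+ ε ℚ.≤ seq y n))

module CauchyProperties where

  half-sum : ∀ ε → ε ℚ.* ½ ℚ.+ ε ℚ.* ½ ≡ ε
  half-sum ε = trans (sym (ℚ.*-distribˡ-+ ε ½ ½)) (ℚ.*-identityʳ ε)

  *-pos : ∀ {p q} → 0ℚ ℚ.< p → 0ℚ ℚ.< q → 0ℚ ℚ.< p ℚ.* q
  *-pos {p} {q} 0<p 0<q =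
    ℚ.positive⁻¹ (p ℚ.* q) {{ℚ.pos*pos⇒pos p {{ℚ.positive 0<p}} q {{ℚ.positive 0<q}}}}

  half-pos : ∀ {ε} → 0ℚ ℚ.< ε → 0ℚ ℚ.< ε ℚ.* ½
  half-pos 0<ε = *-pos 0<ε (ℚ.positive⁻¹ ½)

  ∣p∣<ε : ∀ {p ε} → p ℚ.< ε → ℚ.- p ℚ.< ε → ℚ.∣ p ∣ ℚ.< ε
  ∣p∣<ε {p} p<ε -p<ε with ℚ.∣p∣≡p∨∣p∣≡-p p
  ... | inj₁ eq = subst (ℚ._< _) (sym eq) p<ε
  ... | inj₂ eq = subst (ℚ._< _) (sym eq) -p<ε

  p≤∣p∣ : ∀ p → p ℚ.≤ ℚ.∣ p ∣
  p≤∣p∣ p with ℚ.≤-total 0ℚ p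
  ... | inj₁ 0≤p = ℚ.≤-reflexive (sym (ℚ.0≤p⇒∣p∣≡p 0≤p))
  ... | inj₂ p≤0 = ℚ.≤-trans p≤0 (ℚ.0≤∣p∣ p)

  neg-minus : ∀ p q → ℚ.- (p ℚ.- q) ≡ q ℚ.- p
  neg-minus = solve 2 (λ p q → :- (p :- q) := q :- p) refl
    where open +-*-Solver

  ∣-∣-comm : ∀ p q → ℚ.∣ p ℚ.- q ∣ ≡ ℚ.∣ q ℚ.- p ∣
  ∣-∣-comm p q = trans (sym (ℚ.∣-p∣≡∣p∣ (p ℚ.- q))) (cong ℚ.∣_∣ (neg-minus p q))

  p≡q+[p-q] : ∀ p q → p ≡ q ℚ.+ (p ℚ.- q)
  p≡q+[p-q] = solve 2 (λ p q → p := q :+ (p :- q)) refl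
    where open +-*-Solver

  *-distribˡ-minus : ∀ p q r → p ℚ.* (q ℚ.- r) ≡ p ℚ.* q ℚ.- p ℚ.* r
  *-distribˡ-minus p q r =
    trans (ℚ.*-distribˡ-+ p q (ℚ.- r)) (cong (p ℚ.* q ℚ.+_) (sym (ℚ.neg-distribʳ-* p r)))

  telescope : ∀ p q r → p ℚ.- r ≡ (p ℚ.- q) ℚ.+ (q ℚ.- r)
  telescope = solve 3 (λ p q r → p :- r := (p :- q) :+ (q :- r)) refl
    where open +-*-Solver

  *-mono-≤-nonNeg : ∀ {a b c d} → 0ℚ ℚ.≤ c → 0ℚ ℚ.≤ b → a ℚ.≤ b → c ℚ.≤ d → a ℚ.* c ℚ.≤ b ℚ.* d
  *-mono-≤-nonNeg {a} {b} {c} {d} 0≤c 0≤b a≤b c≤d = ℚ.≤-trans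
    (ℚ.*-monoʳ-≤-nonNeg c {{ℚ.nonNegative 0≤c}} a≤b)
    (ℚ.*-monoˡ-≤-nonNeg b {{ℚ.nonNegative 0≤b}} c≤d)

  Bounded : (ℕ → ℚ) → Set
  Bounded x = ∃[ B ] (0ℚ ℚ.< B × ∃[ N ] (∀ n → N ℕ.≤ n → ℚ.∣ x n ∣ ℚ.≤ B))

  cauchy⇒bounded : ∀ {x} → IsCauchy x → Bounded x
  cauchy⇒bounded {x} cx with cx 1ℚ (ℚ.positive⁻¹ 1ℚ)
  ... | N , close = ℚ.∣ x N ∣ ℚ.+ 1ℚ
      , ℚ.+-mono-≤-< (ℚ.0≤∣p∣ (x N)) (ℚ.positive⁻¹ 1ℚ)
      , N , λ n N≤n → begin
          ℚ.∣ x n ∣                           ≡⟨ cong ℚ.∣_∣ (p≡q+[p-q] (x n) (x N)) ⟩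
          ℚ.∣ x N ℚ.+ (x n ℚ.- x N) ∣         ≤⟨ ℚ.∣p+q∣≤∣p∣+∣q∣ (x N) (x n ℚ.- x N) ⟩
          ℚ.∣ x N ∣ ℚ.+ ℚ.∣ x n ℚ.- x N ∣     ≤⟨ ℚ.+-monoʳ-≤ ℚ.∣ x N ∣ (ℚ.<⇒≤ (close n N N≤n ℕ.≤-refl)) ⟩
          ℚ.∣ x N ∣ ℚ.+ 1ℚ                    ∎
    where open ℚ.≤-Reasoning

  const-cauchy : ∀ q → IsCauchy (λ _ → q)
  const-cauchy q ε 0<ε = 0 , λ _ _ _ _ →
    subst (ℚ._< ε) (sym (cong ℚ.∣_∣ (ℚ.+-inverseʳ q))) 0<ε

  neg-cauchy : ∀ {x} → IsCauchy x → IsCauchy (λ n → ℚ.- x n)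
  neg-cauchy {x} cx ε 0<ε with cx ε 0<ε
  ... | N , close = N , λ m n N≤m N≤n →
      subst (ℚ._< ε) (trans (sym (ℚ.∣-p∣≡∣p∣ (x m ℚ.- x n)))
                            (cong ℚ.∣_∣ (ℚ.neg-distrib-+ (x m) (ℚ.- x n))))
            (close m n N≤m N≤n)

  +-cauchy : ∀ {x y} → IsCauchy x → IsCauchy y → IsCauchy (λ n → x n ℚ.+ y n)
  +-cauchy {x} {y} cx cy ε 0<ε with cx (ε ℚ.* ½) (half-pos 0<ε) | cy (ε ℚ.* ½) (half-pos 0<ε)
  ... | N₁ , close₁ | N₂ , close₂ = N₁ ℕ.⊔ N₂ , λ m n N≤m N≤n → begin-strict
      ℚ.∣ (x m ℚ.+ y m) ℚ.- (x n ℚ.+ y n) ∣      ≡⟨ cong ℚ.∣_∣ (regroup (x m) (y m) (x n) (y n)) ⟩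
      ℚ.∣ (x m ℚ.- x n) ℚ.+ (y m ℚ.- y n) ∣      ≤⟨ ℚ.∣p+q∣≤∣p∣+∣q∣ (x m ℚ.- x n) (y m ℚ.- y n) ⟩
      ℚ.∣ x m ℚ.- x n ∣ ℚ.+ ℚ.∣ y m ℚ.- y n ∣    <⟨ ℚ.+-mono-<
          (close₁ m n (ℕ.m⊔n≤o⇒m≤o N₁ N₂ N≤m) (ℕ.m⊔n≤o⇒m≤o N₁ N₂ N≤n))
          (close₂ m n (ℕ.m⊔n≤o⇒n≤o N₁ N₂ N≤m) (ℕ.m⊔n≤o⇒n≤o N₁ N₂ N≤n)) ⟩
      ε ℚ.* ½ ℚ.+ ε ℚ.* ½                        ≡⟨ half-sum ε ⟩
      ε                                          ∎
    where
    open ℚ.≤-Reasoning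
    regroup : ∀ a b c d → (a ℚ.+ b) ℚ.- (c ℚ.+ d) ≡ (a ℚ.- c) ℚ.+ (b ℚ.- d)
    regroup = solve 4 (λ a b c d → (a :+ b) :- (c :+ d) := (a :- c) :+ (b :- d)) refl
      where open +-*-Solver

  scale : ∀ B ε → 0ℚ ℚ.< B → 0ℚ ℚ.< ε → ∃[ δ ] (0ℚ ℚ.< δ × B ℚ.* δ ≡ ε)
  scale B ε 0<B 0<ε = 1/B ℚ.* ε
    , *-pos (ℚ.positive⁻¹ 1/B {{ℚ.1/pos⇒pos B {{ℚ.positive 0<B}}}}) 0<ε
    , trans (sym (ℚ.*-assoc B 1/B ε))
            (trans (cong (ℚ._* ε) (ℚ.*-inverseʳ B {{B≢0}})) (ℚ.*-identityˡ ε))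
    where
    B≢0 : ℚ.NonZero B
    B≢0 = ℚ.pos⇒nonZero B {{ℚ.positive 0<B}}
    1/B : ℚ
    1/B = ℚ.1/_ B {{B≢0}}

  *-close : ∀ a b c d {A B δ₁ δ₂ ε} → 0ℚ ℚ.< A → 0ℚ ℚ.< B →
            A ℚ.* δ₂ ≡ ε ℚ.* ½ → B ℚ.* δ₁ ≡ ε ℚ.* ½ →
            ℚ.∣ a ∣ ℚ.≤ A → ℚ.∣ d ∣ ℚ.≤ B →
            ℚ.∣ a ℚ.- c ∣ ℚ.< δ₁ → ℚ.∣ b ℚ.- d ∣ ℚ.< δ₂ →
            ℚ.∣ a ℚ.* b ℚ.- c ℚ.* d ∣ ℚ.< ε
  *-close a b c d {A} {B} {δ₁} {δ₂} {ε} 0<A 0<B Aδ₂≡ε/2 Bδ₁≡ε/2 a≤A d≤B ac bd = begin-strict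
      ℚ.∣ a ℚ.* b ℚ.- c ℚ.* d ∣                        ≡⟨ cong ℚ.∣_∣ regroup ⟩
      ℚ.∣ a ℚ.* b-d ℚ.+ d ℚ.* a-c ∣                    ≤⟨ ℚ.∣p+q∣≤∣p∣+∣q∣ (a ℚ.* b-d) (d ℚ.* a-c) ⟩
      ℚ.∣ a ℚ.* b-d ∣ ℚ.+ ℚ.∣ d ℚ.* a-c ∣              ≡⟨ cong₂ ℚ._+_ (ℚ.∣p*q∣≡∣p∣*∣q∣ a b-d) (ℚ.∣p*q∣≡∣p∣*∣q∣ d a-c) ⟩
      ℚ.∣ a ∣ ℚ.* ℚ.∣ b-d ∣ ℚ.+ ℚ.∣ d ∣ ℚ.* ℚ.∣ a-c ∣  ≤⟨ ℚ.+-mono-≤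
          (ℚ.*-monoʳ-≤-nonNeg ℚ.∣ b-d ∣ {{ℚ.∣-∣-nonNeg b-d}} a≤A)
          (ℚ.*-monoʳ-≤-nonNeg ℚ.∣ a-c ∣ {{ℚ.∣-∣-nonNeg a-c}} d≤B) ⟩
      A ℚ.* ℚ.∣ b-d ∣ ℚ.+ B ℚ.* ℚ.∣ a-c ∣              <⟨ ℚ.+-mono-<
          (ℚ.*-monoʳ-<-pos A {{ℚ.positive 0<A}} bd)
          (ℚ.*-monoʳ-<-pos B {{ℚ.positive 0<B}} ac) ⟩
      A ℚ.* δ₂ ℚ.+ B ℚ.* δ₁                            ≡⟨ cong₂ ℚ._+_ Aδ₂≡ε/2 Bδ₁≡ε/2 ⟩
      ε ℚ.* ½ ℚ.+ ε ℚ.* ½                              ≡⟨ half-sum ε ⟩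
      ε                                                ∎
    where
    open ℚ.≤-Reasoning
    b-d a-c : ℚ
    b-d = b ℚ.- d
    a-c = a ℚ.- c
    regroup : a ℚ.* b ℚ.- c ℚ.* d ≡ a ℚ.* b-d ℚ.+ d ℚ.* a-c
    regroup = trans (telescope (a ℚ.* b) (a ℚ.* d) (c ℚ.* d))
      (cong₂ ℚ._+_ (sym (*-distribˡ-minus a b d))
        (trans (cong₂ ℚ._-_ (ℚ.*-comm a d) (ℚ.*-comm c d)) (sym (*-distribˡ-minus d a c))))

  *-cauchy : ∀ {x y} → IsCauchy x → IsCauchy y → IsCauchy (λ n → x n ℚ.* y n)
  *-cauchy {x} {y} cx cy ε 0<ε =
    let A , 0<A , M₁ , x≤A = cauchy⇒bounded {x} cx
        B , 0<B , M₂ , y≤B = cauchy⇒bounded {y} cy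
        δ₁ , 0<δ₁ , Bδ₁≡ε/2 = scale B (ε ℚ.* ½) 0<B (half-pos 0<ε)
        δ₂ , 0<δ₂ , Aδ₂≡ε/2 = scale A (ε ℚ.* ½) 0<A (half-pos 0<ε)
        N₁ , close₁ = cx δ₁ 0<δ₁
        N₂ , close₂ = cy δ₂ 0<δ₂
        M = M₁ ℕ.⊔ M₂
        N = N₁ ℕ.⊔ N₂
    in M ℕ.⊔ N , λ m n K≤m K≤n →
      let M≤m = ℕ.m⊔n≤o⇒m≤o M N K≤m
          M≤n = ℕ.m⊔n≤o⇒m≤o M N K≤n
          N≤m = ℕ.m⊔n≤o⇒n≤o M N K≤m
          N≤n = ℕ.m⊔n≤o⇒n≤o M N K≤n
      in *-close (x m) (y m) (x n) (y n) 0<A 0<B Aδ₂≡ε/2 Bδ₁≡ε/2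
           (x≤A m (ℕ.m⊔n≤o⇒m≤o M₁ M₂ M≤m)) (y≤B n (ℕ.m⊔n≤o⇒n≤o M₁ M₂ M≤n))
           (close₁ m n (ℕ.m⊔n≤o⇒m≤o N₁ N₂ N≤m) (ℕ.m⊔n≤o⇒m≤o N₁ N₂ N≤n))
           (close₂ m n (ℕ.m⊔n≤o⇒n≤o N₁ N₂ N≤m) (ℕ.m⊔n≤o⇒n≤o N₁ N₂ N≤n))

  minus<⇒< : ∀ {p q ε} → p ℚ.- q ℚ.< ε → p ℚ.< q ℚ.+ ε
  minus<⇒< {p} {q} {ε} lt =
    subst (ℚ._< q ℚ.+ ε) (sym (p≡q+[p-q] p q)) (ℚ.+-monoʳ-< q lt)

  <⇒minus< : ∀ {p q ε} → p ℚ.< q ℚ.+ ε → p ℚ.- q ℚ.< ε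
  <⇒minus< {p} {q} {ε} lt =
    subst (p ℚ.- q ℚ.<_) (cancel q ε) (ℚ.+-monoˡ-< (ℚ.- q) lt)
    where
    cancel : ∀ a b → a ℚ.+ b ℚ.- a ≡ b
    cancel = solve 2 (λ a b → a :+ b :- a := b) refl
      where open +-*-Solver

  ⊓-close : ∀ a b c d {ε} → ℚ.∣ a ℚ.- c ∣ ℚ.< ε → ℚ.∣ b ℚ.- d ∣ ℚ.< ε →
            (a ℚ.⊓ b) ℚ.- (c ℚ.⊓ d) ℚ.< ε
  ⊓-close a b c d {ε} ac bd with ℚ.⊓-sel c d
  ... | inj₁ eq = <⇒minus< (subst (λ t → a ℚ.⊓ b ℚ.< t ℚ.+ ε) (sym eq)
      (ℚ.≤-<-trans (ℚ.p⊓q≤p a b) (minus<⇒< (ℚ.≤-<-trans (p≤∣p∣ (a ℚ.- c)) ac))))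
  ... | inj₂ eq = <⇒minus< (subst (λ t → a ℚ.⊓ b ℚ.< t ℚ.+ ε) (sym eq)
      (ℚ.≤-<-trans (ℚ.p⊓q≤q a b) (minus<⇒< (ℚ.≤-<-trans (p≤∣p∣ (b ℚ.- d)) bd))))

  ⊓-cauchy : ∀ {x y} → IsCauchy x → IsCauchy y → IsCauchy (λ n → x n ℚ.⊓ y n)
  ⊓-cauchy {x} {y} cx cy ε 0<ε with cx ε 0<ε | cy ε 0<ε
  ... | N₁ , close₁ | N₂ , close₂ = N₁ ℕ.⊔ N₂ , λ m n N≤m N≤n →
      let xmn = close₁ m n (ℕ.m⊔n≤o⇒m≤o N₁ N₂ N≤m) (ℕ.m⊔n≤o⇒m≤o N₁ N₂ N≤n)
          ymn = close₂ m n (ℕ.m⊔n≤o⇒n≤o N₁ N₂ N≤m) (ℕ.m⊔n≤o⇒n≤o N₁ N₂ N≤n)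
      in ∣p∣<ε (⊓-close (x m) (y m) (x n) (y n) xmn ymn)
               (subst (ℚ._< ε) (sym (neg-minus (x m ℚ.⊓ y m) (x n ℚ.⊓ y n)))
                 (⊓-close (x n) (y n) (x m) (y m)
                   (subst (ℚ._< ε) (∣-∣-comm (x m) (x n)) xmn)
                   (subst (ℚ._< ε) (∣-∣-comm (y m) (y n)) ymn)))

open CauchyProperties

fromℚ : ℚ → ℝ
fromℚ q = mkℝ (λ _ → q) (const-cauchy q)

fromℕ : ℕ → ℝ
fromℕ n = fromℚ (+ n ℚ./ 1)

0ℝ 1ℝ : ℝ
0ℝ = fromℚ 0ℚ
1ℝ = fromℚ 1ℚ

infixl 6 _+_ _-_
infixl 7 _*_ _/ℕ_ _⊓_
infixr 8 _^_
infix  9 -_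

_+_ : ℝ → ℝ → ℝ
x + y = mkℝ (λ n → seq x n ℚ.+ seq y n) (+-cauchy {seq x} {seq y} (cauchy x) (cauchy y))

-_ : ℝ → ℝ
- x = mkℝ (λ n → ℚ.- seq x n) (neg-cauchy {seq x} (cauchy x))

_-_ : ℝ → ℝ → ℝ
x - y = x + (- y)

_*_ : ℝ → ℝ → ℝ
x * y = mkℝ (λ n → seq x n ℚ.* seq y n) (*-cauchy {seq x} {seq y} (cauchy x) (cauchy y))

_⊓_ : ℝ → ℝ → ℝ
x ⊓ y = mkℝ (λ n → seq x n ℚ.⊓ seq y n) (⊓-cauchy {seq x} {seq y} (cauchy x) (cauchy y))

_^_ : ℝ → ℕ → ℝ
x ^ zero  = 1ℝ
x ^ suc n = x * x ^ n

_/ℕ_ : ℝ → (d : ℕ) .{{_ : NonZero d}} → ℝ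
x /ℕ d = x * fromℚ (+ 1 ℚ./ d)

∑ : List ℝ → ℝ
∑ = foldr _+_ 0ℝ

-- The value at 0 is irrelevant: the sequence of a positive real has only
-- finitely many zero terms.
recip : ℚ → ℚ
recip q with q ℚ.≟ 0ℚ
... | yes _  = 0ℚ
... | no q≢0 = ℚ.1/_ q {{ℚ.≢-nonZero q≢0}}

module RecipProperties where

  recip-inverse : ∀ q → 0ℚ ℚ.< q → q ℚ.* recip q ≡ 1ℚ
  recip-inverse q 0<q with q ℚ.≟ 0ℚ
  ... | yes q≡0 = contradiction (sym q≡0) (ℚ.<⇒≢ 0<q)
  ... | no q≢0  = ℚ.*-inverseʳ q {{ℚ.≢-nonZero q≢0}}

  -- For a, b ≥ δ > 0:  δ²·|1/a − 1/b| ≤ |a·b·(1/a − 1/b)| = |a − b|.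
  recip-lipschitz : ∀ {δ} a b → 0ℚ ℚ.< δ → δ ℚ.≤ a → δ ℚ.≤ b →
                    (δ ℚ.* δ) ℚ.* ℚ.∣ recip a ℚ.- recip b ∣ ℚ.≤ ℚ.∣ a ℚ.- b ∣
  recip-lipschitz {δ} a b 0<δ δ≤a δ≤b = begin
      (δ ℚ.* δ) ℚ.* ℚ.∣ r ∣              ≤⟨ ℚ.*-monoʳ-≤-nonNeg ℚ.∣ r ∣ {{ℚ.∣-∣-nonNeg r}}
                                             (*-mono-≤-nonNeg (ℚ.<⇒≤ 0<δ) (ℚ.<⇒≤ 0<a) δ≤a δ≤b) ⟩
      (a ℚ.* b) ℚ.* ℚ.∣ r ∣              ≡⟨ cong (ℚ._* ℚ.∣ r ∣) (sym (ℚ.0≤p⇒∣p∣≡p (ℚ.<⇒≤ (*-pos 0<a 0<b)))) ⟩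
      ℚ.∣ a ℚ.* b ∣ ℚ.* ℚ.∣ r ∣          ≡⟨ sym (ℚ.∣p*q∣≡∣p∣*∣q∣ (a ℚ.* b) r) ⟩
      ℚ.∣ (a ℚ.* b) ℚ.* r ∣              ≡⟨ cong ℚ.∣_∣ expand ⟩
      ℚ.∣ b ℚ.- a ∣                      ≡⟨ ∣-∣-comm b a ⟩
      ℚ.∣ a ℚ.- b ∣                      ∎
    where
    open ℚ.≤-Reasoning
    r = recip a ℚ.- recip b
    0<a = ℚ.<-≤-trans 0<δ δ≤a
    0<b = ℚ.<-≤-trans 0<δ δ≤b
    regroup : ∀ a b s t → (a ℚ.* b) ℚ.* (s ℚ.- t) ≡ (a ℚ.* s) ℚ.* b ℚ.- (b ℚ.* t) ℚ.* a
    regroup a b s t = trans (*-distribˡ-minus (a ℚ.* b) s t) (cong₂ ℚ._-_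
      (trans (ℚ.*-assoc a b s) (trans (cong (a ℚ.*_) (ℚ.*-comm b s)) (sym (ℚ.*-assoc a s b))))
      (trans (ℚ.*-assoc a b t) (ℚ.*-comm a (b ℚ.* t))))
    expand : (a ℚ.* b) ℚ.* r ≡ b ℚ.- a
    expand = trans (regroup a b (recip a) (recip b))
      (cong₂ ℚ._-_ (trans (cong (ℚ._* b) (recip-inverse a 0<a)) (ℚ.*-identityˡ b))
                   (trans (cong (ℚ._* a) (recip-inverse b 0<b)) (ℚ.*-identityˡ a)))

  recip-cauchy : ∀ x → 0ℝ < x → IsCauchy (λ n → recip (seq x n))
  recip-cauchy x (δ , 0<δ , M , δ≤x) ε 0<ε
    with cauchy x ((δ ℚ.* δ) ℚ.* ε) (*-pos (*-pos 0<δ 0<δ) 0<ε)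
  ... | N , close = M ℕ.⊔ N , λ m n K≤m K≤n →
      ℚ.*-cancelˡ-<-nonNeg (δ ℚ.* δ) {{ℚ.nonNegative (ℚ.<⇒≤ (*-pos 0<δ 0<δ))}}
        (ℚ.≤-<-trans
          (recip-lipschitz (seq x m) (seq x n) 0<δ
            (bound m (ℕ.m⊔n≤o⇒m≤o M N K≤m)) (bound n (ℕ.m⊔n≤o⇒m≤o M N K≤n)))
          (close m n (ℕ.m⊔n≤o⇒n≤o M N K≤m) (ℕ.m⊔n≤o⇒n≤o M N K≤n)))
    where
    bound : ∀ n → M ℕ.≤ n → δ ℚ.≤ seq x n
    bound n M≤n = subst (ℚ._≤ seq x n) (ℚ.+-identityˡ δ) (δ≤x n M≤n)

open RecipProperties

inv : (x : ℝ) → 0ℝ < x → ℝ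
inv x 0<x = mkℝ (λ n → recip (seq x n)) (recip-cauchy x 0<x)

------------------------------------------------------------------------
-- Families of subsets of an N-element ground set; {0, …, n} is the case
-- N = suc n.

Family : ℕ → Set
Family N = Subset N → Bool

infix 4 _∈ᶠ_

_∈ᶠ_ : ∀ {N} → Subset N → Family N → Set
S ∈ᶠ 𝒜 = T (𝒜 S)

subsets : ∀ N → List (Subset N)
subsets zero    = [] ∷ []
subsets (suc N) = map (outside ∷_) (subsets N) ++ map (inside ∷_) (subsets N)

#_ : ∀ {N} {P : Pred (Subset N) 0ℓ} → Decidable P → ℕ
#_ {N} P? = length (filter P? (subsets N))

Monotone : ∀ {N} → Family N → Set
Monotone 𝒜 = ∀ A B → A ∈ᶠ 𝒜 → A ⊆ B → B ∈ᶠ 𝒜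

Minterm : ∀ {N} → Family N → Subset N → Set
Minterm 𝒜 M = M ∈ᶠ 𝒜 × (∀ B → B ⊂ M → ¬ B ∈ᶠ 𝒜)

minterm? : ∀ {N} (𝒜 : Family N) → Decidable (Minterm 𝒜)
minterm? 𝒜 M = T? (𝒜 M) ×-dec
  map′ (λ none B B⊂M B∈𝒜 → none (B , B⊂M , B∈𝒜))
       (λ min (B , B⊂M , B∈𝒜) → min B B⊂M B∈𝒜)
       (¬? (anySubset? (λ B → (B ⊂? M) ×-dec T? (𝒜 B))))

MintermsOfSizeAtMost : ∀ {N} → ℕ → Family N → Set
MintermsOfSizeAtMost k 𝒜 = ∀ M → Minterm 𝒜 M → ∣ M ∣ ℕ.≤ k

Supplement : ∀ {N} → Family N → ℕ → Subset N → Subset N → Set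
Supplement 𝒜 m V W = ∣ W ∣ ≡ m × W ∩ V ≡ ⊥ × Minterm 𝒜 (W ∪ V)

supplement? : ∀ {N} (𝒜 : Family N) m V → Decidable (Supplement 𝒜 m V)
supplement? 𝒜 m V W =
  (∣ W ∣ ℕ.≟ m) ×-dec ≡-dec Bool._≟_ (W ∩ V) ⊥ ×-dec minterm? 𝒜 (W ∪ V)

Tame : ∀ {N} → ℕ → (p : ℝ) → 0ℝ < p → Family N → Set
Tame k p 0<p 𝒜 = ∀ m → 1 ℕ.≤ m → m ℕ.≤ k ℕ.∸ 1 → ∀ V →
  fromℕ (# supplement? 𝒜 m V) < inv p 0<p ^ m

------------------------------------------------------------------------
-- Product measure on the subsets of an N-element ground set

-- Pr(random subset = S): independent choices for the elements.
weight : ∀ {N} → ℝ → Subset N → ℝ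
weight p []            = 1ℝ
weight p (inside  ∷ S) = p * weight p S
weight p (outside ∷ S) = (1ℝ - p) * weight p S

𝔼 : ∀ {N} → ℝ → (Subset N → ℝ) → ℝ
𝔼 {N} p X = ∑ (map (λ S → weight p S * X S) (subsets N))

μ : ∀ {N} → ℝ → Family N → ℝ
μ {N} p 𝒜 = ∑ (map (weight p) (filter (λ S → T? (𝒜 S)) (subsets N)))

X : ∀ {N} → Family N → Subset N → ℝ
X 𝒜 S = fromℕ (# (λ M → minterm? 𝒜 M ×-dec (M ⊆? S)))

k*2^k≢0 : ∀ k .{{_ : NonZero k}} → NonZero (k ℕ.* 2 ℕ.^ k)
k*2^k≢0 k {{k≢0}} = ℕ.m*n≢0 k (2 ℕ.^ k) {{k≢0}} {{ℕ.m^n≢0 2 k}}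

{-# OPTIONS --safe #-}
module Submission where

-- Second moment method. Let X count the minterms inside the random set, E = 𝔼 X and K = k 2ᵏ.
-- Conditioned on a minterm M being present, split the other minterms M′ by V = M′ ∩ M and
-- m = ∣ M′ ─ M ∣. For 1 ≤ m < k tameness bounds each of these at most (k − 1) 2ᵏ classes by 1;
-- M′ = M contributes 1, and m = k forces V = ∅, contributing at most E in total. Since 2ᵏ ≥ 2,
-- 𝔼[X²] ≤ E (E + K − 1). Integrating 1[X > 0] ≥ 2ℓX − ℓ²X² gives μ ≥ ℓE whenever
-- ℓ (E + K − 1) ≤ 1; take ℓ = 1/K if E ≤ 1 and ℓ = 1/(EK) otherwise.
-- All of this is done for rational p ∈ [0,1] and transferred to Cauchy sequences termwise, after
-- replacing p by p ⊓ 1.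

open import Defs
open import Data.Nat as ℕ using (ℕ; suc; NonZero)

open import Algebra.Bundles using (module CommutativeRing)
import Algebra.Properties.CommutativeSemiring.Exp as Exp
open import Data.Bool using (T?)
open import Data.Fin as Fin using (Fin; toℕ; fromℕ<)
import Data.Fin.Properties as Fin
open import Data.Fin.Subset using (Subset; inside; outside; _⊆_; _⊂_; _∩_; _∪_; _─_; ∣_∣; ⊥)
open import Data.Fin.Subset.Properties using (_⊆?_; ⊆-antisym; drop-∷-⊆; out⊆; in⊆in; p∩q⊆q; ∣p─q∣≤∣p∣; _∈?_; ⊆-trans; p⊆p∪q; q⊆p∪q; x∈p∪q⁻)
open import Data.Integer as ℤ using (+_)
import Data.Integer.Properties as ℤ
open import Data.List using (List; []; _∷_; map; _++_; filter; length; allFin)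
open import Data.List.Properties using (length-tabulate)
open import Data.List.Membership.Propositional using (_∈_)
open import Data.List.Membership.Propositional.Properties using (∈-map⁺; ∈-++⁺ˡ; ∈-++⁺ʳ; ∈-allFin)
open import Data.List.Relation.Unary.Any using (here; there)
import Data.Nat.Properties as ℕ
open import Data.Product using (∃-syntax; _×_; _,_; proj₁; proj₂)
open import Data.Rational as ℚ using (ℚ; 0ℚ; 1ℚ)
import Data.Rational.Properties as ℚ
import Data.Rational.Unnormalised as ℚᵘ
import Data.Rational.Unnormalised.Properties as ℚᵘ
open import Data.Rational.Solver using (module +-*-Solver)
open import Data.Sum using (_⊎_; inj₁; inj₂; [_,_])
open import Data.Vec using ([]; _∷_)
open import Data.Vec.Properties using (≡-dec; ∷-injectiveˡ; ∷-injectiveʳ)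
import Data.Bool.Properties as Bool
open import Function using (_∘_; case_of_)
open import Relation.Binary.PropositionalEquality using (_≡_; _≢_; refl; sym; trans; cong; cong₂; subst; module ≡-Reasoning)
open import Relation.Nullary using (Dec; yes; no; ¬_; contradiction)
open import Relation.Nullary.Decidable using (_×-dec_)
open import Relation.Unary using (Pred; Decidable)
open import Level using (0ℓ)

open CauchyProperties
open RecipProperties
open Exp (CommutativeRing.commutativeSemiring ℚ.+-*-commutativeRing) using (^-homo-*; ^-distrib-*) renaming (_^_ to infixr 8 _^ℚ_)

-- Cauchy-Schwarz would give `E / (E + K - 1)` as a lower bound for the measure. Integrating a
-- quadratic with a free parameter `ℓ` needs no division by a moment and covers `E = 0`. Both
-- choices of `ℓ` lie below the optimum `1 / (E + K - 1)` and are taken so that `ℓ E` is exactly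
-- `min(E, 1) / K`. The factor `2ᵏ` counts the possible traces `V` inside one minterm `M`, and
-- `k - 1` counts the sizes to which tameness applies. For real `p` no term of the sequence need
-- satisfy the hypotheses from the start. Strict real inequalities hold termwise from some index on,
-- and only finitely many pairs `(m, V)` occur, so one index serves them all. The condition `p ≤ 1`
-- is not strict and may fail at every term, which is what forces the cap. The cap changes the
-- sequence, so both sides must be seen to depend continuously on `p`. No modulus of continuity is
-- computed: the real operations already carry Cauchy proofs, and applying them to an interleaved
-- sequence yields continuity.

private variable
  A B : Set
  P Q : Set

-- Rational arithmetic

*-nonNeg : ∀ {p q} → 0ℚ ℚ.≤ p → 0ℚ ℚ.≤ q → 0ℚ ℚ.≤ p ℚ.* q
*-nonNeg {p} {q} 0≤p 0≤q = ℚ.nonNegative⁻¹ (p ℚ.* q)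
  {{ℚ.nonNeg*nonNeg⇒nonNeg p {{ℚ.nonNegative 0≤p}} q {{ℚ.nonNegative 0≤q}}}}

*-monoˡ-≤ : ∀ {p q r} → 0ℚ ℚ.≤ r → p ℚ.≤ q → r ℚ.* p ℚ.≤ r ℚ.* q
*-monoˡ-≤ {r = r} 0≤r = ℚ.*-monoˡ-≤-nonNeg r {{ℚ.nonNegative 0≤r}}

*-monoʳ-≤ : ∀ {p q r} → 0ℚ ℚ.≤ r → p ℚ.≤ q → p ℚ.* r ℚ.≤ q ℚ.* r
*-monoʳ-≤ {r = r} 0≤r = ℚ.*-monoʳ-≤-nonNeg r {{ℚ.nonNegative 0≤r}}

p≤q⇒0≤q-p : ∀ {p q} → p ℚ.≤ q → 0ℚ ℚ.≤ q ℚ.- p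
p≤q⇒0≤q-p {p} {q} p≤q = subst (ℚ._≤ q ℚ.- p) (ℚ.+-inverseʳ p) (ℚ.+-monoˡ-≤ (ℚ.- p) p≤q)

0≤q-p⇒p≤q : ∀ {p q} → 0ℚ ℚ.≤ q ℚ.- p → p ℚ.≤ q
0≤q-p⇒p≤q {p} {q} 0≤q-p = begin
  p                  ≡⟨ ℚ.+-identityʳ p ⟨
  p ℚ.+ 0ℚ           ≤⟨ ℚ.+-monoʳ-≤ p 0≤q-p ⟩
  p ℚ.+ (q ℚ.- p)    ≡⟨ p≡q+[p-q] q p ⟨
  q                  ∎
  where open ℚ.≤-Reasoning

p≤p+q : ∀ {p q} → 0ℚ ℚ.≤ q → p ℚ.≤ p ℚ.+ q
p≤p+q {p} {q} 0≤q = subst (ℚ._≤ p ℚ.+ q) (ℚ.+-identityʳ p) (ℚ.+-monoʳ-≤ p 0≤q)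

q≤p+q : ∀ {p q} → 0ℚ ℚ.≤ p → q ℚ.≤ p ℚ.+ q
q≤p+q {p} {q} 0≤p = subst (ℚ._≤ p ℚ.+ q) (ℚ.+-identityˡ q) (ℚ.+-monoˡ-≤ q 0≤p)

0≤p² : ∀ p → 0ℚ ℚ.≤ p ℚ.* p
0≤p² p with ℚ.≤-total 0ℚ p
... | inj₁ 0≤p = *-nonNeg 0≤p 0≤p
... | inj₂ p≤0 = subst (0ℚ ℚ.≤_) (negSquare p) (*-nonNeg 0≤-p 0≤-p)
  where
  0≤-p : 0ℚ ℚ.≤ ℚ.- p
  0≤-p = ℚ.neg-antimono-≤ p≤0
  negSquare : ∀ p → (ℚ.- p) ℚ.* (ℚ.- p) ≡ p ℚ.* p
  negSquare = solve 1 (λ p → (:- p) :* (:- p) := p :* p) refl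
    where open +-*-Solver

^-nonNeg : ∀ {q} → 0ℚ ℚ.≤ q → ∀ m → 0ℚ ℚ.≤ q ^ℚ m
^-nonNeg 0≤q ℕ.zero  = ℚ.nonNegative⁻¹ 1ℚ
^-nonNeg 0≤q (suc m) = *-nonNeg 0≤q (^-nonNeg 0≤q m)

^-monoˡ-≤ : ∀ {p q} → 0ℚ ℚ.≤ p → p ℚ.≤ q → ∀ m → p ^ℚ m ℚ.≤ q ^ℚ m
^-monoˡ-≤ 0≤p p≤q ℕ.zero  = ℚ.≤-refl
^-monoˡ-≤ 0≤p p≤q (suc m) =
  *-mono-≤-nonNeg (^-nonNeg 0≤p m) (ℚ.≤-trans 0≤p p≤q) p≤q (^-monoˡ-≤ 0≤p p≤q m)

1^m≡1 : ∀ m → 1ℚ ^ℚ m ≡ 1ℚ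
1^m≡1 ℕ.zero  = refl
1^m≡1 (suc m) = trans (ℚ.*-identityˡ (1ℚ ^ℚ m)) (1^m≡1 m)

-- Fractions in `ℚ` are normalised by a gcd, which blocks computation with a variable numerator.
-- Identities between such fractions are therefore checked by cross-multiplication in `ℚᵘ` and
-- carried over along `fromℚᵘ`.
fromℚᵘ-homo-+ : ∀ x y → ℚ.fromℚᵘ (x ℚᵘ.+ y) ≡ ℚ.fromℚᵘ x ℚ.+ ℚ.fromℚᵘ y
fromℚᵘ-homo-+ x y = ℚ.toℚᵘ-injective (ℚᵘ.≃-trans (ℚ.toℚᵘ-fromℚᵘ (x ℚᵘ.+ y)) (ℚᵘ.≃-sym
  (ℚᵘ.≃-trans (ℚ.toℚᵘ-homo-+ (ℚ.fromℚᵘ x) (ℚ.fromℚᵘ y))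
              (ℚᵘ.+-cong (ℚ.toℚᵘ-fromℚᵘ x) (ℚ.toℚᵘ-fromℚᵘ y)))))

fromℚᵘ-homo-* : ∀ x y → ℚ.fromℚᵘ (x ℚᵘ.* y) ≡ ℚ.fromℚᵘ x ℚ.* ℚ.fromℚᵘ y
fromℚᵘ-homo-* x y = ℚ.toℚᵘ-injective (ℚᵘ.≃-trans (ℚ.toℚᵘ-fromℚᵘ (x ℚᵘ.* y)) (ℚᵘ.≃-sym
  (ℚᵘ.≃-trans (ℚ.toℚᵘ-homo-* (ℚ.fromℚᵘ x) (ℚ.fromℚᵘ y))
              (ℚᵘ.*-cong (ℚ.toℚᵘ-fromℚᵘ x) (ℚ.toℚᵘ-fromℚᵘ y)))))

-- Every term of `fromℕ n` is `ι n` by definition, so the counts in `Tame` and `X` turn into `ι`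
-- without rewriting.
ι : ℕ → ℚ
ι n = + n ℚ./ 1

ι-homo-+ : ∀ m n → ι (m ℕ.+ n) ≡ ι m ℚ.+ ι n
ι-homo-+ m n = trans
  (ℚ.fromℚᵘ-cong {ℚᵘ.mkℚᵘ (+ (m ℕ.+ n)) 0} {ℚᵘ.mkℚᵘ (+ m) 0 ℚᵘ.+ ℚᵘ.mkℚᵘ (+ n) 0}
    (ℚᵘ.*≡* (cong (ℤ._* + 1) (cong₂ ℤ._+_ (sym (ℤ.*-identityʳ (+ m))) (sym (ℤ.*-identityʳ (+ n)))))))
  (fromℚᵘ-homo-+ (ℚᵘ.mkℚᵘ (+ m) 0) (ℚᵘ.mkℚᵘ (+ n) 0))

ι-homo-* : ∀ m n → ι (m ℕ.* n) ≡ ι m ℚ.* ι n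
ι-homo-* m n = trans
  (ℚ.fromℚᵘ-cong {ℚᵘ.mkℚᵘ (+ (m ℕ.* n)) 0} {ℚᵘ.mkℚᵘ (+ m) 0 ℚᵘ.* ℚᵘ.mkℚᵘ (+ n) 0}
    (ℚᵘ.*≡* (cong (ℤ._* + 1) (ℤ.pos-* m n))))
  (fromℚᵘ-homo-* (ℚᵘ.mkℚᵘ (+ m) 0) (ℚᵘ.mkℚᵘ (+ n) 0))

1/d*d≡1 : ∀ d .{{_ : NonZero d}} → (+ 1 ℚ./ d) ℚ.* ι d ≡ 1ℚ
1/d*d≡1 (suc d) = trans (sym (fromℚᵘ-homo-* (ℚᵘ.mkℚᵘ (+ 1) d) (ℚᵘ.mkℚᵘ (+ suc d) 0)))
  (ℚ.fromℚᵘ-cong {ℚᵘ.mkℚᵘ (+ 1) d ℚᵘ.* ℚᵘ.mkℚᵘ (+ suc d) 0} {ℚᵘ.mkℚᵘ (+ 1) 0}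
    (ℚᵘ.*≡* (trans (ℤ.*-identityʳ (+ 1 ℤ.* + suc d)) (cong +_
      (cong (1 ℕ.*_) (sym (ℕ.*-identityʳ (suc d))))))))

0≤ι : ∀ n → 0ℚ ℚ.≤ ι n
0≤ι n = ℚ.nonNegative⁻¹ (ι n) {{ℚ.normalize-nonNeg n 1}}

ι-mono-≤ : ∀ {m n} → m ℕ.≤ n → ι m ℚ.≤ ι n
ι-mono-≤ {m} {n} m≤n = subst (ι m ℚ.≤_)
  (trans (sym (ι-homo-+ m (n ℕ.∸ m))) (cong ι (ℕ.m+[n∸m]≡n m≤n)))
  (p≤p+q (0≤ι (n ℕ.∸ m)))

*-left-comm : ∀ a b c → a ℚ.* (b ℚ.* c) ≡ b ℚ.* (a ℚ.* c)
*-left-comm = solve 3 (λ a b c → a :* (b :* c) := b :* (a :* c)) refl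
  where open +-*-Solver

-- Finite sums

sumOver : List A → (A → ℚ) → ℚ
sumOver []       f = 0ℚ
sumOver (x ∷ xs) f = f x ℚ.+ sumOver xs f

syntax sumOver xs (λ x → e) = ∑[ x ∈ xs ] e

∑-cong : ∀ (xs : List A) {f g : A → ℚ} → (∀ x → f x ≡ g x) → sumOver xs f ≡ sumOver xs g
∑-cong []       f≡g = refl
∑-cong (x ∷ xs) f≡g = cong₂ ℚ._+_ (f≡g x) (∑-cong xs f≡g)

∑-mono : ∀ (xs : List A) {f g : A → ℚ} → (∀ x → f x ℚ.≤ g x) → sumOver xs f ℚ.≤ sumOver xs g
∑-mono []       f≤g = ℚ.≤-refl
∑-mono (x ∷ xs) f≤g = ℚ.+-mono-≤ (f≤g x) (∑-mono xs f≤g)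

∑-zero : ∀ (xs : List A) → ∑[ x ∈ xs ] 0ℚ ≡ 0ℚ
∑-zero []       = refl
∑-zero (x ∷ xs) = trans (ℚ.+-identityˡ _) (∑-zero xs)

∑-nonNeg : ∀ (xs : List A) {f : A → ℚ} → (∀ x → 0ℚ ℚ.≤ f x) → 0ℚ ℚ.≤ sumOver xs f
∑-nonNeg xs {f} 0≤f = subst (ℚ._≤ sumOver xs f) (∑-zero xs) (∑-mono xs 0≤f)

∑-one : ∀ (xs : List A) → ∑[ x ∈ xs ] 1ℚ ≡ ι (length xs)
∑-one []       = refl
∑-one (x ∷ xs) = trans (cong (1ℚ ℚ.+_) (∑-one xs)) (sym (ι-homo-+ 1 (length xs)))

∑-distrib-+ : ∀ (xs : List A) (f g : A → ℚ) →
              ∑[ x ∈ xs ] (f x ℚ.+ g x) ≡ sumOver xs f ℚ.+ sumOver xs g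
∑-distrib-+ []       f g = refl
∑-distrib-+ (x ∷ xs) f g = trans (cong (f x ℚ.+ g x ℚ.+_) (∑-distrib-+ xs f g))
  (interchange (f x) (g x) (sumOver xs f) (sumOver xs g))
  where
  interchange : ∀ a b c d → (a ℚ.+ b) ℚ.+ (c ℚ.+ d) ≡ (a ℚ.+ c) ℚ.+ (b ℚ.+ d)
  interchange = solve 4 (λ a b c d → (a :+ b) :+ (c :+ d) := (a :+ c) :+ (b :+ d)) refl
    where open +-*-Solver

*-distribˡ-∑ : ∀ (xs : List A) c (f : A → ℚ) → c ℚ.* sumOver xs f ≡ ∑[ x ∈ xs ] (c ℚ.* f x)
*-distribˡ-∑ []       c f = ℚ.*-zeroʳ c
*-distribˡ-∑ (x ∷ xs) c f = trans (ℚ.*-distribˡ-+ c (f x) (sumOver xs f))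
  (cong (c ℚ.* f x ℚ.+_) (*-distribˡ-∑ xs c f))

*-distribʳ-∑ : ∀ (xs : List A) c (f : A → ℚ) → sumOver xs f ℚ.* c ≡ ∑[ x ∈ xs ] (f x ℚ.* c)
*-distribʳ-∑ xs c f = trans (ℚ.*-comm (sumOver xs f) c)
  (trans (*-distribˡ-∑ xs c f) (∑-cong xs (λ x → ℚ.*-comm c (f x))))

∑-swap : ∀ (xs : List A) (ys : List B) (f : A → B → ℚ) →
         ∑[ x ∈ xs ] (∑[ y ∈ ys ] f x y) ≡ ∑[ y ∈ ys ] (∑[ x ∈ xs ] f x y)
∑-swap []       ys f = sym (∑-zero ys)
∑-swap (x ∷ xs) ys f = trans (cong (sumOver ys (f x) ℚ.+_) (∑-swap xs ys f))
  (sym (∑-distrib-+ ys (f x) (λ y → ∑[ x′ ∈ xs ] f x′ y)))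

∑-++ : ∀ (xs ys : List A) (f : A → ℚ) → sumOver (xs ++ ys) f ≡ sumOver xs f ℚ.+ sumOver ys f
∑-++ []       ys f = sym (ℚ.+-identityˡ (sumOver ys f))
∑-++ (x ∷ xs) ys f = trans (cong (f x ℚ.+_) (∑-++ xs ys f))
  (sym (ℚ.+-assoc (f x) (sumOver xs f) (sumOver ys f)))

∑-map : ∀ (h : A → B) (xs : List A) (f : B → ℚ) → sumOver (map h xs) f ≡ sumOver xs (f ∘ h)
∑-map h []       f = refl
∑-map h (x ∷ xs) f = cong (f (h x) ℚ.+_) (∑-map h xs f)

term≤∑ : ∀ {x} {xs : List A} (f : A → ℚ) → (∀ y → 0ℚ ℚ.≤ f y) → x ∈ xs → f x ℚ.≤ sumOver xs f
term≤∑ {xs = y ∷ xs} f 0≤f (here refl)  = p≤p+q (∑-nonNeg xs 0≤f)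
term≤∑ {xs = y ∷ xs} f 0≤f (there x∈xs) = ℚ.≤-trans (term≤∑ f 0≤f x∈xs) (q≤p+q (0≤f y))

-- Indicators

ind : Dec P → ℚ
ind (yes _) = 1ℚ
ind (no _)  = 0ℚ

0≤ind : (P? : Dec P) → 0ℚ ℚ.≤ ind P?
0≤ind (yes _) = ℚ.nonNegative⁻¹ 1ℚ
0≤ind (no _)  = ℚ.≤-refl

ind-true : (P? : Dec P) → P → ind P? ≡ 1ℚ
ind-true (yes _) p = refl
ind-true (no ¬p) p = contradiction p ¬p

ind-false : (P? : Dec P) → ¬ P → ind P? ≡ 0ℚ
ind-false (yes p) ¬p = contradiction p ¬p
ind-false (no _)  ¬p = refl

ind-cong : (P? : Dec P) (Q? : Dec Q) → (P → Q) → (Q → P) → ind P? ≡ ind Q?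
ind-cong (yes p) Q? p⇒q q⇒p = sym (ind-true Q? (p⇒q p))
ind-cong (no ¬p) Q? p⇒q q⇒p = sym (ind-false Q? (¬p ∘ q⇒p))

ind-× : (P? : Dec P) (Q? : Dec Q) → ind (P? ×-dec Q?) ≡ ind P? ℚ.* ind Q?
ind-× (yes _) (yes _) = refl
ind-× (yes _) (no _)  = refl
ind-× (no _)  (yes _) = refl
ind-× (no _)  (no _)  = refl

∑-filter : ∀ {P : Pred A 0ℓ} (P? : Decidable P) xs (f : A → ℚ) →
           sumOver (filter P? xs) f ≡ ∑[ x ∈ xs ] (ind (P? x) ℚ.* f x)
∑-filter P? []       f = refl
∑-filter P? (x ∷ xs) f with P? x
... | yes _ = cong₂ ℚ._+_ (sym (ℚ.*-identityˡ (f x))) (∑-filter P? xs f)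
... | no _  = trans (∑-filter P? xs f)
  (sym (trans (cong (ℚ._+ _) (ℚ.*-zeroˡ (f x))) (ℚ.+-identityˡ _)))

#≡∑ind : ∀ {N} {P : Pred (Subset N) 0ℓ} (P? : Decidable P) →
         ι (# P?) ≡ ∑[ S ∈ subsets N ] ind (P? S)
#≡∑ind {N} P? = trans (sym (∑-one (filter P? (subsets N))))
  (trans (∑-filter P? (subsets N) (λ _ → 1ℚ)) (∑-cong (subsets N) (λ S → ℚ.*-identityʳ (ind (P? S)))))

-- Subsets

∈-subsets : ∀ {N} (S : Subset N) → S ∈ subsets N
∈-subsets []            = here refl
∈-subsets (outside ∷ S) = ∈-++⁺ˡ (∈-map⁺ (outside ∷_) (∈-subsets S))
∈-subsets (inside ∷ S)  = ∈-++⁺ʳ (map (outside ∷_) (subsets _)) (∈-map⁺ (inside ∷_) (∈-subsets S))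

∑-subsets-suc : ∀ {N} (f : Subset (suc N) → ℚ) → sumOver (subsets (suc N)) f ≡
                ∑[ S ∈ subsets N ] f (outside ∷ S) ℚ.+ ∑[ S ∈ subsets N ] f (inside ∷ S)
∑-subsets-suc {N} f = trans (∑-++ (map (outside ∷_) (subsets N)) (map (inside ∷_) (subsets N)) f)
  (cong₂ ℚ._+_ (∑-map (outside ∷_) (subsets N) f) (∑-map (inside ∷_) (subsets N) f))

infix 4 _≟ˢ_

_≟ˢ_ : ∀ {N} (S U : Subset N) → Dec (S ≡ U)
_≟ˢ_ = ≡-dec Bool._≟_

∑-≡ : ∀ {N} (U : Subset N) → ∑[ S ∈ subsets N ] ind (S ≟ˢ U) ≡ 1ℚ
∑-≡ [] = refl
∑-≡ {suc N} (u ∷ U) = trans (∑-subsets-suc (λ S → ind (S ≟ˢ u ∷ U))) (split u)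
  where
  equal : ∀ b → ∑[ S ∈ subsets N ] ind (b ∷ S ≟ˢ b ∷ U) ≡ 1ℚ
  equal b = trans (∑-cong (subsets N) (λ S →
    ind-cong (b ∷ S ≟ˢ b ∷ U) (S ≟ˢ U) ∷-injectiveʳ (cong (b ∷_)))) (∑-≡ U)
  distinct : ∀ b c → b ≢ c → ∑[ S ∈ subsets N ] ind (b ∷ S ≟ˢ c ∷ U) ≡ 0ℚ
  distinct b c b≢c = trans (∑-cong (subsets N) (λ S →
    ind-false (b ∷ S ≟ˢ c ∷ U) (b≢c ∘ ∷-injectiveˡ))) (∑-zero (subsets N))
  split : ∀ u → ∑[ S ∈ subsets N ] ind (outside ∷ S ≟ˢ u ∷ U) ℚ.+
                ∑[ S ∈ subsets N ] ind (inside ∷ S ≟ˢ u ∷ U) ≡ 1ℚ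
  split outside = cong₂ ℚ._+_ (equal outside) (distinct inside outside (λ ()))
  split inside  = cong₂ ℚ._+_ (distinct outside inside (λ ())) (equal inside)

in⊈out : ∀ {N} {M S : Subset N} → ¬ (inside ∷ M ⊆ outside ∷ S)
in⊈out M⊆S = case M⊆S Data.Vec.here of λ ()

∑-⊆ : ∀ {N} (M : Subset N) → ∑[ V ∈ subsets N ] ind (V ⊆? M) ≡ ι (2 ℕ.^ ∣ M ∣)
∑-⊆ [] = refl
∑-⊆ {suc N} (b ∷ M) = trans (∑-subsets-suc (λ V → ind (V ⊆? b ∷ M))) (split b)
  where
  out : ∀ b → ∑[ V ∈ subsets N ] ind (outside ∷ V ⊆? b ∷ M) ≡ ι (2 ℕ.^ ∣ M ∣)
  out b = trans (∑-cong (subsets N) (λ V →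
    ind-cong (outside ∷ V ⊆? b ∷ M) (V ⊆? M) drop-∷-⊆ out⊆)) (∑-⊆ M)
  split : ∀ b → ∑[ V ∈ subsets N ] ind (outside ∷ V ⊆? b ∷ M) ℚ.+
                ∑[ V ∈ subsets N ] ind (inside ∷ V ⊆? b ∷ M) ≡ ι (2 ℕ.^ ∣ b ∷ M ∣)
  split outside = trans (cong₂ ℚ._+_ (out outside) (trans (∑-cong (subsets N) (λ V →
    ind-false (inside ∷ V ⊆? outside ∷ M) in⊈out)) (∑-zero (subsets N)))) (ℚ.+-identityʳ _)
  split inside = trans (cong₂ ℚ._+_ (out inside) (trans (∑-cong (subsets N) (λ V →
    ind-cong (inside ∷ V ⊆? inside ∷ M) (V ⊆? M) drop-∷-⊆ in⊆in)) (∑-⊆ M)))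
    (trans (sym (ι-homo-+ (2 ℕ.^ ∣ M ∣) (2 ℕ.^ ∣ M ∣)))
           (cong (λ n → ι (2 ℕ.^ ∣ M ∣ ℕ.+ n)) (sym (ℕ.+-identityʳ (2 ℕ.^ ∣ M ∣)))))

∣p∪q∣≡∣p∣+∣q─p∣ : ∀ {N} (p q : Subset N) → ∣ p ∪ q ∣ ≡ ∣ p ∣ ℕ.+ ∣ q ─ p ∣
∣p∪q∣≡∣p∣+∣q─p∣ []            []            = refl
∣p∪q∣≡∣p∣+∣q─p∣ (inside ∷ p)  (_ ∷ q)       = cong suc (∣p∪q∣≡∣p∣+∣q─p∣ p q)
∣p∪q∣≡∣p∣+∣q─p∣ (outside ∷ p) (inside ∷ q)  =
  trans (cong suc (∣p∪q∣≡∣p∣+∣q─p∣ p q)) (sym (ℕ.+-suc ∣ p ∣ ∣ q ─ p ∣))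
∣p∪q∣≡∣p∣+∣q─p∣ (outside ∷ p) (outside ∷ q) = ∣p∪q∣≡∣p∣+∣q─p∣ p q

[p─q]∪[p∩q]≡p : ∀ {N} (p q : Subset N) → (p ─ q) ∪ (p ∩ q) ≡ p
[p─q]∪[p∩q]≡p []            []            = refl
[p─q]∪[p∩q]≡p (inside ∷ p)  (inside ∷ q)  = cong (inside ∷_) ([p─q]∪[p∩q]≡p p q)
[p─q]∪[p∩q]≡p (inside ∷ p)  (outside ∷ q) = cong (inside ∷_) ([p─q]∪[p∩q]≡p p q)
[p─q]∪[p∩q]≡p (outside ∷ p) (inside ∷ q)  = cong (outside ∷_) ([p─q]∪[p∩q]≡p p q)
[p─q]∪[p∩q]≡p (outside ∷ p) (outside ∷ q) = cong (outside ∷_) ([p─q]∪[p∩q]≡p p q)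

[p─q]∩[p∩q]≡⊥ : ∀ {N} (p q : Subset N) → (p ─ q) ∩ (p ∩ q) ≡ ⊥
[p─q]∩[p∩q]≡⊥ []            []            = refl
[p─q]∩[p∩q]≡⊥ (inside ∷ p)  (inside ∷ q)  = cong (outside ∷_) ([p─q]∩[p∩q]≡⊥ p q)
[p─q]∩[p∩q]≡⊥ (inside ∷ p)  (outside ∷ q) = cong (outside ∷_) ([p─q]∩[p∩q]≡⊥ p q)
[p─q]∩[p∩q]≡⊥ (outside ∷ p) (inside ∷ q)  = cong (outside ∷_) ([p─q]∩[p∩q]≡⊥ p q)
[p─q]∩[p∩q]≡⊥ (outside ∷ p) (outside ∷ q) = cong (outside ∷_) ([p─q]∩[p∩q]≡⊥ p q)

∣p─q∣≡0⇒p⊆q : ∀ {N} (p q : Subset N) → ∣ p ─ q ∣ ≡ 0 → p ⊆ q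
∣p─q∣≡0⇒p⊆q []            []            _   = λ ()
∣p─q∣≡0⇒p⊆q (inside ∷ p)  (inside ∷ q)  eq  = in⊆in (∣p─q∣≡0⇒p⊆q p q eq)
∣p─q∣≡0⇒p⊆q (outside ∷ p) (inside ∷ q)  eq  = out⊆ (∣p─q∣≡0⇒p⊆q p q eq)
∣p─q∣≡0⇒p⊆q (outside ∷ p) (outside ∷ q) eq  = out⊆ (∣p─q∣≡0⇒p⊆q p q eq)

p⊆q∧p⊄q⇒p≡q : ∀ {N} {p q : Subset N} → p ⊆ q → ¬ (p ⊂ q) → p ≡ q
p⊆q∧p⊄q⇒p≡q {p = p} {q} p⊆q p⊄q = ⊆-antisym p⊆q q⊆p
  where
  q⊆p : q ⊆ p
  q⊆p {x} x∈q with x ∈? p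
  ... | yes x∈p = x∈p
  ... | no x∉p  = contradiction ((λ {x} → p⊆q {x}) , x , x∈q , x∉p) p⊄q

ind-∪⊆ : ∀ {N} (M M′ S : Subset N) → ind (M ∪ M′ ⊆? S) ≡ ind (M ⊆? S) ℚ.* ind (M′ ⊆? S)
ind-∪⊆ M M′ S = trans
  (ind-cong (M ∪ M′ ⊆? S) (M ⊆? S ×-dec M′ ⊆? S)
    (λ ∪⊆S → ⊆-trans (p⊆p∪q M′) ∪⊆S , ⊆-trans (q⊆p∪q M M′) ∪⊆S)
    (λ (M⊆S , M′⊆S) x∈∪ → [ M⊆S , M′⊆S ] (x∈p∪q⁻ M M′ x∈∪)))
  (ind-× (M ⊆? S) (M′ ⊆? S))

-- Product weights at a rational parameter

weightℚ : ∀ {N} → ℚ → Subset N → ℚ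
weightℚ q []            = 1ℚ
weightℚ q (inside  ∷ S) = q ℚ.* weightℚ q S
weightℚ q (outside ∷ S) = (1ℚ ℚ.- q) ℚ.* weightℚ q S

weightℚ-nonNeg : ∀ {N q} → 0ℚ ℚ.≤ q → q ℚ.≤ 1ℚ → (S : Subset N) → 0ℚ ℚ.≤ weightℚ q S
weightℚ-nonNeg 0≤q q≤1 []            = ℚ.nonNegative⁻¹ 1ℚ
weightℚ-nonNeg 0≤q q≤1 (inside  ∷ S) = *-nonNeg 0≤q (weightℚ-nonNeg 0≤q q≤1 S)
weightℚ-nonNeg 0≤q q≤1 (outside ∷ S) = *-nonNeg (p≤q⇒0≤q-p q≤1) (weightℚ-nonNeg 0≤q q≤1 S)

-- The sum factors over coordinates. A coordinate outside `M` contributes `(1 - q) + q = 1`; a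
-- coordinate in `M` contributes only `q`, because the sets that omit it do not contain `M`.
∑-weight-⊇ : ∀ {N} q (M : Subset N) →
             ∑[ S ∈ subsets N ] (weightℚ q S ℚ.* ind (M ⊆? S)) ≡ q ^ℚ ∣ M ∣
∑-weight-⊇ q [] = refl
∑-weight-⊇ {suc N} q (b ∷ M) =
  trans (∑-subsets-suc (λ S → weightℚ q S ℚ.* ind (b ∷ M ⊆? S))) (split b)
  where
  factor : ∀ c b s → (∀ S → ind (b ∷ M ⊆? s ∷ S) ≡ ind (M ⊆? S)) →
    ∑[ S ∈ subsets N ] ((c ℚ.* weightℚ q S) ℚ.* ind (b ∷ M ⊆? s ∷ S)) ≡ c ℚ.* q ^ℚ ∣ M ∣
  factor c b s same = trans
    (∑-cong (subsets N) (λ S → trans (cong (c ℚ.* weightℚ q S ℚ.*_) (same S))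
                                     (ℚ.*-assoc c (weightℚ q S) (ind (M ⊆? S)))))
    (trans (sym (*-distribˡ-∑ (subsets N) c (λ S → weightℚ q S ℚ.* ind (M ⊆? S))))
           (cong (c ℚ.*_) (∑-weight-⊇ q M)))
  total : ∀ q r → (1ℚ ℚ.- q) ℚ.* r ℚ.+ q ℚ.* r ≡ r
  total = solve 2 (λ q r → (con 1ℚ :- q) :* r :+ q :* r := r) refl
    where open +-*-Solver
  split : ∀ b →
    ∑[ S ∈ subsets N ] (((1ℚ ℚ.- q) ℚ.* weightℚ q S) ℚ.* ind (b ∷ M ⊆? outside ∷ S)) ℚ.+
    ∑[ S ∈ subsets N ] ((q ℚ.* weightℚ q S) ℚ.* ind (b ∷ M ⊆? inside ∷ S)) ≡ q ^ℚ ∣ b ∷ M ∣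
  split outside = trans (cong₂ ℚ._+_
      (factor (1ℚ ℚ.- q) outside outside (λ S → ind-cong (outside ∷ M ⊆? outside ∷ S) (M ⊆? S) drop-∷-⊆ out⊆))
      (factor q outside inside (λ S → ind-cong (outside ∷ M ⊆? inside ∷ S) (M ⊆? S) drop-∷-⊆ out⊆)))
    (total q (q ^ℚ ∣ M ∣))
  split inside = trans (cong₂ ℚ._+_
      (trans (∑-cong (subsets N) (λ S → trans
               (cong ((1ℚ ℚ.- q) ℚ.* weightℚ q S ℚ.*_) (ind-false (inside ∷ M ⊆? outside ∷ S) in⊈out))
               (ℚ.*-zeroʳ ((1ℚ ℚ.- q) ℚ.* weightℚ q S))))
             (∑-zero (subsets N)))
      (factor q inside inside (λ S → ind-cong (inside ∷ M ⊆? inside ∷ S) (M ⊆? S) drop-∷-⊆ in⊆in)))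
    (ℚ.+-identityˡ (q ℚ.* q ^ℚ ∣ M ∣))

-- The second moment method

-- Split `k * 2 ^ k` as `2 ^ k + (k - 1) * 2 ^ k` and use `2 ≤ 2 ^ k`. One unit of the leading 2
-- pays for `M′ = M`; the other is the gap between `K` and `K - 1`.
2+2^i*[k∸1]≤k*2^k : ∀ k .{{_ : NonZero k}} {i} → i ℕ.≤ k → 2 ℕ.+ 2 ℕ.^ i ℕ.* (k ℕ.∸ 1) ℕ.≤ k ℕ.* 2 ℕ.^ k
2+2^i*[k∸1]≤k*2^k k@(suc j) {i} i≤k = ℕ.+-mono-≤
  (ℕ.*-monoʳ-≤ 2 (ℕ.m^n>0 2 j))
  (ℕ.≤-trans (ℕ.*-monoˡ-≤ j (ℕ.^-monoʳ-≤ 2 i≤k)) (ℕ.≤-reflexive (ℕ.*-comm (2 ℕ.^ k) j)))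

-- Tameness cleared of its denominator and made non-strict. The sizes `suc (toℕ i)` run through 1 to
-- `k - 1`; indexing them by `Fin` makes them a finite list, over which one can sum and take a
-- common threshold.
TameAt : ∀ {N} → ℕ → ℚ → Family N → Set
TameAt k q 𝒜 = ∀ (i : Fin (k ℕ.∸ 1)) V →
  ι (# supplement? 𝒜 (suc (toℕ i)) V) ℚ.* q ^ℚ suc (toℕ i) ℚ.≤ 1ℚ

module Moments {N} (𝒜 : Family N) (q : ℚ) where

  minterm : Subset N → ℚ
  minterm M = ind (minterm? 𝒜 M)

  mintermsIn : Subset N → ℚ
  mintermsIn S = ∑[ M ∈ subsets N ] (minterm M ℚ.* ind (M ⊆? S))

  firstMoment : ℚ
  firstMoment = ∑[ S ∈ subsets N ] (weightℚ q S ℚ.* mintermsIn S)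

  secondMoment : ℚ
  secondMoment = ∑[ S ∈ subsets N ] (weightℚ q S ℚ.* (mintermsIn S ℚ.* mintermsIn S))

  measure : ℚ
  measure = ∑[ S ∈ subsets N ] (ind (T? (𝒜 S)) ℚ.* weightℚ q S)

  -- Up to the factor q ^ ∣ M ∣, the expectation of mintermsIn on the event that M is contained
  -- in the random set.
  degree : Subset N → ℚ
  degree M = ∑[ M′ ∈ subsets N ] (minterm M′ ℚ.* q ^ℚ ∣ M′ ─ M ∣)

  -- Double counting of pairs `M ⊆ S`. The weight `u` is left free for three uses: the plain weight
  -- for the first moment, the weight times `mintermsIn` for the second, and the weight cut down to
  -- the sets containing a fixed minterm.
  ∑-mintermsIn : (u : Subset N → ℚ) → ∑[ S ∈ subsets N ] (u S ℚ.* mintermsIn S) ≡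
                 ∑[ M ∈ subsets N ] (minterm M ℚ.* ∑[ S ∈ subsets N ] (u S ℚ.* ind (M ⊆? S)))
  ∑-mintermsIn u = begin
    ∑[ S ∈ subsets N ] (u S ℚ.* mintermsIn S)
      ≡⟨ ∑-cong (subsets N) (λ S → *-distribˡ-∑ (subsets N) (u S) (λ M → minterm M ℚ.* ind (M ⊆? S))) ⟩
    ∑[ S ∈ subsets N ] (∑[ M ∈ subsets N ] (u S ℚ.* (minterm M ℚ.* ind (M ⊆? S))))
      ≡⟨ ∑-swap (subsets N) (subsets N) (λ S M → u S ℚ.* (minterm M ℚ.* ind (M ⊆? S))) ⟩
    ∑[ M ∈ subsets N ] (∑[ S ∈ subsets N ] (u S ℚ.* (minterm M ℚ.* ind (M ⊆? S))))
      ≡⟨ ∑-cong (subsets N) (λ M → trans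
           (∑-cong (subsets N) (λ S → *-left-comm (u S) (minterm M) (ind (M ⊆? S))))
           (sym (*-distribˡ-∑ (subsets N) (minterm M) (λ S → u S ℚ.* ind (M ⊆? S))))) ⟩
    ∑[ M ∈ subsets N ] (minterm M ℚ.* ∑[ S ∈ subsets N ] (u S ℚ.* ind (M ⊆? S))) ∎
    where
    open ≡-Reasoning

  firstMoment≡ : firstMoment ≡ ∑[ M ∈ subsets N ] (minterm M ℚ.* q ^ℚ ∣ M ∣)
  firstMoment≡ = trans (∑-mintermsIn (weightℚ q))
    (∑-cong (subsets N) (λ M → cong (minterm M ℚ.*_) (∑-weight-⊇ q M)))

  -- A set contains both `M` and `M′` exactly when it contains `M ∪ M′`. That event has mass
  -- `q ^ ∣ M ∪ M′ ∣`, and `M ∪ M′` is `M` together with the disjoint part `M′ ─ M`.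
  ∑-weight-⊇-mintermsIn : ∀ M →
    ∑[ S ∈ subsets N ] ((weightℚ q S ℚ.* mintermsIn S) ℚ.* ind (M ⊆? S)) ≡ q ^ℚ ∣ M ∣ ℚ.* degree M
  ∑-weight-⊇-mintermsIn M = begin
    ∑[ S ∈ subsets N ] ((weightℚ q S ℚ.* mintermsIn S) ℚ.* ind (M ⊆? S))
      ≡⟨ ∑-cong (subsets N) (λ S → swapʳ (weightℚ q S) (mintermsIn S) (ind (M ⊆? S))) ⟩
    ∑[ S ∈ subsets N ] ((weightℚ q S ℚ.* ind (M ⊆? S)) ℚ.* mintermsIn S)
      ≡⟨ ∑-mintermsIn (λ S → weightℚ q S ℚ.* ind (M ⊆? S)) ⟩
    ∑[ M′ ∈ subsets N ] (minterm M′ ℚ.*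
      ∑[ S ∈ subsets N ] ((weightℚ q S ℚ.* ind (M ⊆? S)) ℚ.* ind (M′ ⊆? S)))
      ≡⟨ ∑-cong (subsets N) (λ M′ → cong (minterm M′ ℚ.*_) (joint M′)) ⟩
    ∑[ M′ ∈ subsets N ] (minterm M′ ℚ.* (q ^ℚ ∣ M ∣ ℚ.* q ^ℚ ∣ M′ ─ M ∣))
      ≡⟨ ∑-cong (subsets N) (λ M′ → *-left-comm (minterm M′) (q ^ℚ ∣ M ∣) (q ^ℚ ∣ M′ ─ M ∣)) ⟩
    ∑[ M′ ∈ subsets N ] (q ^ℚ ∣ M ∣ ℚ.* (minterm M′ ℚ.* q ^ℚ ∣ M′ ─ M ∣))
      ≡⟨ *-distribˡ-∑ (subsets N) (q ^ℚ ∣ M ∣) (λ M′ → minterm M′ ℚ.* q ^ℚ ∣ M′ ─ M ∣) ⟨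
    q ^ℚ ∣ M ∣ ℚ.* degree M ∎
    where
    open ≡-Reasoning
    swapʳ : ∀ a b c → (a ℚ.* b) ℚ.* c ≡ (a ℚ.* c) ℚ.* b
    swapʳ = solve 3 (λ a b c → (a :* b) :* c := (a :* c) :* b) refl
      where open +-*-Solver
    joint : ∀ M′ → ∑[ S ∈ subsets N ] ((weightℚ q S ℚ.* ind (M ⊆? S)) ℚ.* ind (M′ ⊆? S)) ≡
                   q ^ℚ ∣ M ∣ ℚ.* q ^ℚ ∣ M′ ─ M ∣
    joint M′ = begin
      ∑[ S ∈ subsets N ] ((weightℚ q S ℚ.* ind (M ⊆? S)) ℚ.* ind (M′ ⊆? S))
        ≡⟨ ∑-cong (subsets N) (λ S → trans (ℚ.*-assoc (weightℚ q S) (ind (M ⊆? S)) (ind (M′ ⊆? S)))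
             (cong (weightℚ q S ℚ.*_) (sym (ind-∪⊆ M M′ S)))) ⟩
      ∑[ S ∈ subsets N ] (weightℚ q S ℚ.* ind (M ∪ M′ ⊆? S))  ≡⟨ ∑-weight-⊇ q (M ∪ M′) ⟩
      q ^ℚ ∣ M ∪ M′ ∣                                          ≡⟨ cong (q ^ℚ_) (∣p∪q∣≡∣p∣+∣q─p∣ M M′) ⟩
      q ^ℚ (∣ M ∣ ℕ.+ ∣ M′ ─ M ∣)                              ≡⟨ ^-homo-* q ∣ M ∣ ∣ M′ ─ M ∣ ⟩
      q ^ℚ ∣ M ∣ ℚ.* q ^ℚ ∣ M′ ─ M ∣                           ∎

  secondMoment≡ : secondMoment ≡ ∑[ M ∈ subsets N ] (minterm M ℚ.* (q ^ℚ ∣ M ∣ ℚ.* degree M))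
  secondMoment≡ = trans
    (∑-cong (subsets N) (λ S → sym (ℚ.*-assoc (weightℚ q S) (mintermsIn S) (mintermsIn S))))
    (trans (∑-mintermsIn (λ S → weightℚ q S ℚ.* mintermsIn S))
           (∑-cong (subsets N) (λ M → cong (minterm M ℚ.*_) (∑-weight-⊇-mintermsIn M))))

  mintermsIn≡0 : Monotone 𝒜 → ∀ S → ¬ S ∈ᶠ 𝒜 → mintermsIn S ≡ 0ℚ
  mintermsIn≡0 mono S S∉𝒜 = trans (∑-cong (subsets N) absent) (∑-zero (subsets N))
    where
    absent : ∀ M → minterm M ℚ.* ind (M ⊆? S) ≡ 0ℚ
    absent M = trans (sym (ind-× (minterm? 𝒜 M) (M ⊆? S)))
      (ind-false (minterm? 𝒜 M ×-dec M ⊆? S) (λ ((M∈𝒜 , _) , M⊆S) → S∉𝒜 (mono M S M∈𝒜 M⊆S)))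

  module _ (0≤q : 0ℚ ℚ.≤ q) where

    0≤firstMoment : 0ℚ ℚ.≤ firstMoment
    0≤firstMoment = subst (0ℚ ℚ.≤_) (sym firstMoment≡)
      (∑-nonNeg (subsets N) (λ M → *-nonNeg (0≤ind (minterm? 𝒜 M)) (^-nonNeg 0≤q ∣ M ∣)))

    secondMoment≤ : ∀ D → (∀ M → Minterm 𝒜 M → degree M ℚ.≤ D) →
                    secondMoment ℚ.≤ firstMoment ℚ.* D
    secondMoment≤ D degree≤D = begin
      secondMoment                                                      ≡⟨ secondMoment≡ ⟩
      ∑[ M ∈ subsets N ] (minterm M ℚ.* (q ^ℚ ∣ M ∣ ℚ.* degree M))      ≤⟨ ∑-mono (subsets N) bound ⟩
      ∑[ M ∈ subsets N ] ((minterm M ℚ.* q ^ℚ ∣ M ∣) ℚ.* D)             ≡⟨ *-distribʳ-∑ (subsets N) D (λ M → minterm M ℚ.* q ^ℚ ∣ M ∣) ⟨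
      (∑[ M ∈ subsets N ] (minterm M ℚ.* q ^ℚ ∣ M ∣)) ℚ.* D             ≡⟨ cong (ℚ._* D) firstMoment≡ ⟨
      firstMoment ℚ.* D                                                 ∎
      where
      open ℚ.≤-Reasoning
      bound : ∀ M → minterm M ℚ.* (q ^ℚ ∣ M ∣ ℚ.* degree M) ℚ.≤ (minterm M ℚ.* q ^ℚ ∣ M ∣) ℚ.* D
      bound M with minterm? 𝒜 M
      ... | yes isMin = ℚ.≤-trans (ℚ.≤-reflexive (sym (ℚ.*-assoc 1ℚ (q ^ℚ ∣ M ∣) (degree M))))
        (*-monoˡ-≤ (*-nonNeg (ℚ.nonNegative⁻¹ 1ℚ) (^-nonNeg 0≤q ∣ M ∣)) (degree≤D M isMin))
      ... | no _ = ℚ.≤-reflexive (trans (ℚ.*-zeroˡ (q ^ℚ ∣ M ∣ ℚ.* degree M))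
        (sym (trans (cong (ℚ._* D) (ℚ.*-zeroˡ (q ^ℚ ∣ M ∣))) (ℚ.*-zeroˡ D))))

    -- Integrate 1[S ∈ 𝒜] ≥ 1 − (1 − ℓ X)² = 2ℓX − ℓ²X², in which X vanishes off 𝒜.
    ℓ*firstMoment≤measure : q ℚ.≤ 1ℚ → Monotone 𝒜 → ∀ D → (∀ M → Minterm 𝒜 M → degree M ℚ.≤ D) →
                            ∀ ℓ → 0ℚ ℚ.≤ ℓ → ℓ ℚ.* D ℚ.≤ 1ℚ → ℓ ℚ.* firstMoment ℚ.≤ measure
    ℓ*firstMoment≤measure q≤1 mono D degree≤D ℓ 0≤ℓ ℓD≤1 = 0≤q-p⇒p≤q (subst (0ℚ ℚ.≤_)
        (cancel measure (ℓ ℚ.* firstMoment)) (p≤q⇒0≤q-p integrated))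
      where
      open ℚ.≤-Reasoning
      x : Subset N → ℚ
      x = mintermsIn
      cancel : ∀ a b → (a ℚ.+ b) ℚ.- (b ℚ.+ b) ≡ a ℚ.- b
      cancel = solve 2 (λ a b → (a :+ b) :- (b :+ b) := a :- b) refl
        where open +-*-Solver
      square : ∀ y → (1ℚ ℚ.- y) ℚ.* (1ℚ ℚ.- y) ≡ (1ℚ ℚ.+ y ℚ.* y) ℚ.- (y ℚ.+ y)
      square = solve 1 (λ y → (con 1ℚ :- y) :* (con 1ℚ :- y) := (con 1ℚ :+ y :* y) :- (y :+ y)) refl
        where open +-*-Solver
      pointwise : ∀ S → ℓ ℚ.* x S ℚ.+ ℓ ℚ.* x S ℚ.≤ ind (T? (𝒜 S)) ℚ.+ (ℓ ℚ.* x S) ℚ.* (ℓ ℚ.* x S)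
      pointwise S with T? (𝒜 S)
      ... | yes _   = 0≤q-p⇒p≤q (subst (0ℚ ℚ.≤_) (square (ℓ ℚ.* x S)) (0≤p² (1ℚ ℚ.- ℓ ℚ.* x S)))
      ... | no S∉𝒜 = ℚ.≤-reflexive (subst (λ y → y ℚ.+ y ≡ 0ℚ ℚ.+ y ℚ.* y)
        (sym (trans (cong (ℓ ℚ.*_) (mintermsIn≡0 mono S S∉𝒜)) (ℚ.*-zeroʳ ℓ))) refl)
      lower : ∀ w ℓ y → w ℚ.* (ℓ ℚ.* y ℚ.+ ℓ ℚ.* y) ≡ (ℓ ℚ.+ ℓ) ℚ.* (w ℚ.* y)
      lower = solve 3 (λ w ℓ y → w :* (ℓ :* y :+ ℓ :* y) := (ℓ :+ ℓ) :* (w :* y)) refl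
        where open +-*-Solver
      upper : ∀ w ℓ y i → w ℚ.* (i ℚ.+ (ℓ ℚ.* y) ℚ.* (ℓ ℚ.* y)) ≡ i ℚ.* w ℚ.+ (ℓ ℚ.* ℓ) ℚ.* (w ℚ.* (y ℚ.* y))
      upper = solve 4 (λ w ℓ y i → w :* (i :+ (ℓ :* y) :* (ℓ :* y)) := i :* w :+ (ℓ :* ℓ) :* (w :* (y :* y))) refl
        where open +-*-Solver
      regroup : ∀ ℓ e d → (ℓ ℚ.* ℓ) ℚ.* (e ℚ.* d) ≡ (ℓ ℚ.* e) ℚ.* (ℓ ℚ.* d)
      regroup = solve 3 (λ ℓ e d → (ℓ :* ℓ) :* (e :* d) := (ℓ :* e) :* (ℓ :* d)) refl
        where open +-*-Solver
      -- The condition `ℓ D ≤ 1` lets the quadratic term consume at most one of the two copies of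
      -- `ℓ E` supplied by the linear term; the other copy is the bound.
      quadratic : (ℓ ℚ.* ℓ) ℚ.* secondMoment ℚ.≤ ℓ ℚ.* firstMoment
      quadratic = begin
        (ℓ ℚ.* ℓ) ℚ.* secondMoment               ≤⟨ *-monoˡ-≤ (0≤p² ℓ) (secondMoment≤ D degree≤D) ⟩
        (ℓ ℚ.* ℓ) ℚ.* (firstMoment ℚ.* D)        ≡⟨ regroup ℓ firstMoment D ⟩
        (ℓ ℚ.* firstMoment) ℚ.* (ℓ ℚ.* D)        ≤⟨ *-monoˡ-≤ (*-nonNeg 0≤ℓ 0≤firstMoment) ℓD≤1 ⟩
        (ℓ ℚ.* firstMoment) ℚ.* 1ℚ               ≡⟨ ℚ.*-identityʳ (ℓ ℚ.* firstMoment) ⟩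
        ℓ ℚ.* firstMoment                        ∎
      integrated : ℓ ℚ.* firstMoment ℚ.+ ℓ ℚ.* firstMoment ℚ.≤ measure ℚ.+ ℓ ℚ.* firstMoment
      integrated = begin
        ℓ ℚ.* firstMoment ℚ.+ ℓ ℚ.* firstMoment
          ≡⟨ ℚ.*-distribʳ-+ firstMoment ℓ ℓ ⟨
        (ℓ ℚ.+ ℓ) ℚ.* firstMoment
          ≡⟨ *-distribˡ-∑ (subsets N) (ℓ ℚ.+ ℓ) (λ S → weightℚ q S ℚ.* x S) ⟩
        ∑[ S ∈ subsets N ] ((ℓ ℚ.+ ℓ) ℚ.* (weightℚ q S ℚ.* x S))
          ≡⟨ ∑-cong (subsets N) (λ S → lower (weightℚ q S) ℓ (x S)) ⟨
        ∑[ S ∈ subsets N ] (weightℚ q S ℚ.* (ℓ ℚ.* x S ℚ.+ ℓ ℚ.* x S))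
          ≤⟨ ∑-mono (subsets N) (λ S → *-monoˡ-≤ (weightℚ-nonNeg 0≤q q≤1 S) (pointwise S)) ⟩
        ∑[ S ∈ subsets N ] (weightℚ q S ℚ.* (ind (T? (𝒜 S)) ℚ.+ (ℓ ℚ.* x S) ℚ.* (ℓ ℚ.* x S)))
          ≡⟨ ∑-cong (subsets N) (λ S → upper (weightℚ q S) ℓ (x S) (ind (T? (𝒜 S)))) ⟩
        ∑[ S ∈ subsets N ] (ind (T? (𝒜 S)) ℚ.* weightℚ q S ℚ.+ (ℓ ℚ.* ℓ) ℚ.* (weightℚ q S ℚ.* (x S ℚ.* x S)))
          ≡⟨ ∑-distrib-+ (subsets N) (λ S → ind (T? (𝒜 S)) ℚ.* weightℚ q S)
               (λ S → (ℓ ℚ.* ℓ) ℚ.* (weightℚ q S ℚ.* (x S ℚ.* x S))) ⟩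
        measure ℚ.+ ∑[ S ∈ subsets N ] ((ℓ ℚ.* ℓ) ℚ.* (weightℚ q S ℚ.* (x S ℚ.* x S)))
          ≡⟨ cong (measure ℚ.+_) (*-distribˡ-∑ (subsets N) (ℓ ℚ.* ℓ) (λ S → weightℚ q S ℚ.* (x S ℚ.* x S))) ⟨
        measure ℚ.+ (ℓ ℚ.* ℓ) ℚ.* secondMoment
          ≤⟨ ℚ.+-monoʳ-≤ measure quadratic ⟩
        measure ℚ.+ ℓ ℚ.* firstMoment ∎

    -- Tameness bounds the degree of a minterm

    module _ (k : ℕ) (small : MintermsOfSizeAtMost k 𝒜) (tame : TameAt k q 𝒜) where

      module _ (M : Subset N) (isMin : Minterm 𝒜 M) where

        supplementTerm : Subset N → Fin (k ℕ.∸ 1) → Subset N → ℚ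
        supplementTerm V i W =
          ind (V ⊆? M) ℚ.* (ind (supplement? 𝒜 (suc (toℕ i)) V W) ℚ.* q ^ℚ suc (toℕ i))

        0≤supplementTerm : ∀ V i W → 0ℚ ℚ.≤ supplementTerm V i W
        0≤supplementTerm V i W = *-nonNeg (0≤ind (V ⊆? M))
          (*-nonNeg (0≤ind (supplement? 𝒜 (suc (toℕ i)) V W)) (^-nonNeg 0≤q (suc (toℕ i))))

        -- Sums over all ways to write `M′` as `W ∪ V` with `V ⊆ M`, instead of only `V = M′ ∩ M`
        -- and `W = M′ ─ M`. This may overcount, which is harmless for an upper bound, and the
        -- indicator of `M′ = W ∪ V` lets a later sum over `M′` collapse.
        supplements : Subset N → ℚ
        supplements M′ = ∑[ V ∈ subsets N ] (∑[ i ∈ allFin (k ℕ.∸ 1) ] (∑[ W ∈ subsets N ]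
          (supplementTerm V i W ℚ.* ind (M′ ≟ˢ W ∪ V))))

        -- Once the sum over `M′` is innermost, each triple `(V, i, W)` picks out the single set
        -- `W ∪ V`. What remains for fixed `V ⊆ M` and `i` is the number of supplements times
        -- `q ^ m`, at most 1 by tameness, and there are `2 ^ ∣ M ∣` sets `V` and `k - 1` sizes.
        ∑-supplements≤ : ∑[ M′ ∈ subsets N ] supplements M′ ℚ.≤ ι (2 ℕ.^ ∣ M ∣ ℕ.* (k ℕ.∸ 1))
        ∑-supplements≤ = begin
          ∑[ M′ ∈ subsets N ] supplements M′
            ≡⟨ ∑-swap (subsets N) (subsets N) (λ M′ V → ∑[ i ∈ ms ] (∑[ W ∈ subsets N ] term V M′ i W)) ⟩
          ∑[ V ∈ subsets N ] (∑[ M′ ∈ subsets N ] (∑[ i ∈ ms ] (∑[ W ∈ subsets N ] term V M′ i W)))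
            ≡⟨ ∑-cong (subsets N) (λ V → trans (∑-swap (subsets N) ms (λ M′ i → ∑[ W ∈ subsets N ] term V M′ i W))
                 (∑-cong ms (λ i → trans (∑-swap (subsets N) (subsets N) (λ M′ W → term V M′ i W))
                 (∑-cong (subsets N) (λ W → collapse (supplementTerm V i W) (W ∪ V)))))) ⟩
          ∑[ V ∈ subsets N ] (∑[ i ∈ ms ] (∑[ W ∈ subsets N ] supplementTerm V i W))
            ≤⟨ ∑-mono (subsets N) perV ⟩
          ∑[ V ∈ subsets N ] (ind (V ⊆? M) ℚ.* ι (k ℕ.∸ 1))
            ≡⟨ *-distribʳ-∑ (subsets N) (ι (k ℕ.∸ 1)) (λ V → ind (V ⊆? M)) ⟨
          (∑[ V ∈ subsets N ] ind (V ⊆? M)) ℚ.* ι (k ℕ.∸ 1)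
            ≡⟨ cong (ℚ._* ι (k ℕ.∸ 1)) (∑-⊆ M) ⟩
          ι (2 ℕ.^ ∣ M ∣) ℚ.* ι (k ℕ.∸ 1)
            ≡⟨ ι-homo-* (2 ℕ.^ ∣ M ∣) (k ℕ.∸ 1) ⟨
          ι (2 ℕ.^ ∣ M ∣ ℕ.* (k ℕ.∸ 1)) ∎
          where
          open ℚ.≤-Reasoning
          ms : List (Fin (k ℕ.∸ 1))
          ms = allFin (k ℕ.∸ 1)
          term : Subset N → Subset N → Fin (k ℕ.∸ 1) → Subset N → ℚ
          term V M′ i W = supplementTerm V i W ℚ.* ind (M′ ≟ˢ W ∪ V)
          collapse : ∀ c U → ∑[ M′ ∈ subsets N ] (c ℚ.* ind (M′ ≟ˢ U)) ≡ c
          collapse c U = trans (sym (*-distribˡ-∑ (subsets N) c (λ M′ → ind (M′ ≟ˢ U))))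
            (trans (cong (c ℚ.*_) (∑-≡ U)) (ℚ.*-identityʳ c))
          perSize : ∀ V i → ∑[ W ∈ subsets N ] supplementTerm V i W ℚ.≤ ind (V ⊆? M) ℚ.* 1ℚ
          perSize V i = begin
            ∑[ W ∈ subsets N ] supplementTerm V i W
              ≡⟨ *-distribˡ-∑ (subsets N) (ind (V ⊆? M)) (λ W → ind (supplement? 𝒜 m V W) ℚ.* q ^ℚ m) ⟨
            ind (V ⊆? M) ℚ.* ∑[ W ∈ subsets N ] (ind (supplement? 𝒜 m V W) ℚ.* q ^ℚ m)
              ≡⟨ cong (ind (V ⊆? M) ℚ.*_) (*-distribʳ-∑ (subsets N) (q ^ℚ m) (λ W → ind (supplement? 𝒜 m V W))) ⟨
            ind (V ⊆? M) ℚ.* ((∑[ W ∈ subsets N ] ind (supplement? 𝒜 m V W)) ℚ.* q ^ℚ m)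
              ≡⟨ cong (λ c → ind (V ⊆? M) ℚ.* (c ℚ.* q ^ℚ m)) (#≡∑ind (supplement? 𝒜 m V)) ⟨
            ind (V ⊆? M) ℚ.* (ι (# supplement? 𝒜 m V) ℚ.* q ^ℚ m)
              ≤⟨ *-monoˡ-≤ (0≤ind (V ⊆? M)) (tame i V) ⟩
            ind (V ⊆? M) ℚ.* 1ℚ ∎
            where
            m : ℕ
            m = suc (toℕ i)
          perV : ∀ V → ∑[ i ∈ ms ] (∑[ W ∈ subsets N ] supplementTerm V i W) ℚ.≤ ind (V ⊆? M) ℚ.* ι (k ℕ.∸ 1)
          perV V = begin
            ∑[ i ∈ ms ] (∑[ W ∈ subsets N ] supplementTerm V i W)  ≤⟨ ∑-mono ms (perSize V) ⟩
            ∑[ i ∈ ms ] (ind (V ⊆? M) ℚ.* 1ℚ)                      ≡⟨ *-distribˡ-∑ ms (ind (V ⊆? M)) (λ _ → 1ℚ) ⟨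
            ind (V ⊆? M) ℚ.* ∑[ i ∈ ms ] 1ℚ                        ≡⟨ cong (ind (V ⊆? M) ℚ.*_) (∑-one ms) ⟩
            ind (V ⊆? M) ℚ.* ι (length ms)                         ≡⟨ cong (λ l → ind (V ⊆? M) ℚ.* ι l) (length-tabulate {n = k ℕ.∸ 1} (λ i → i)) ⟩
            ind (V ⊆? M) ℚ.* ι (k ℕ.∸ 1)                           ∎

        0≤supplements : ∀ M′ → 0ℚ ℚ.≤ supplements M′
        0≤supplements M′ = ∑-nonNeg (subsets N) (λ V → ∑-nonNeg (allFin (k ℕ.∸ 1)) (λ i →
          ∑-nonNeg (subsets N) (λ W → *-nonNeg (0≤supplementTerm V i W) (0≤ind (M′ ≟ˢ W ∪ V)))))

        -- All terms of the triple sum are nonnegative, so the one at `V = M′ ∩ M`, `W = M′ ─ M`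
        -- suffices; its three indicators are all 1.
        ^-≤supplements : ∀ M′ → Minterm 𝒜 M′ → ∀ j → ∣ M′ ─ M ∣ ≡ suc j → suc j ℕ.≤ k ℕ.∸ 1 →
                         q ^ℚ suc j ℚ.≤ supplements M′
        ^-≤supplements M′ isMin′ j size j<k∸1 = begin
          q ^ℚ suc j
            ≡⟨ cong (λ j → q ^ℚ suc j) (Fin.toℕ-fromℕ< j<k∸1) ⟨
          q ^ℚ suc (toℕ i)
            ≡⟨ units (q ^ℚ suc (toℕ i)) ⟩
          (1ℚ ℚ.* (1ℚ ℚ.* q ^ℚ suc (toℕ i))) ℚ.* 1ℚ
            ≡⟨ cong₂ ℚ._*_ (cong₂ (λ a b → a ℚ.* (b ℚ.* q ^ℚ suc (toℕ i)))
                 (ind-true (V ⊆? M) (p∩q⊆q M′ M)) (ind-true (supplement? 𝒜 (suc (toℕ i)) V W) isSupplement))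
                 (ind-true (M′ ≟ˢ W ∪ V) (sym ([p─q]∪[p∩q]≡p M′ M))) ⟨
          supplementTerm V i W ℚ.* ind (M′ ≟ˢ W ∪ V)
            ≤⟨ term≤∑ (λ W → supplementTerm V i W ℚ.* ind (M′ ≟ˢ W ∪ V))
                 (λ W → 0≤term V i W) (∈-subsets W) ⟩
          ∑[ W ∈ subsets N ] (supplementTerm V i W ℚ.* ind (M′ ≟ˢ W ∪ V))
            ≤⟨ term≤∑ (λ i → ∑[ W ∈ subsets N ] (supplementTerm V i W ℚ.* ind (M′ ≟ˢ W ∪ V)))
                 (λ i → ∑-nonNeg (subsets N) (0≤term V i)) (∈-allFin i) ⟩
          ∑[ i ∈ allFin (k ℕ.∸ 1) ] (∑[ W ∈ subsets N ] (supplementTerm V i W ℚ.* ind (M′ ≟ˢ W ∪ V)))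
            ≤⟨ term≤∑ (λ V → ∑[ i ∈ allFin (k ℕ.∸ 1) ] (∑[ W ∈ subsets N ] (supplementTerm V i W ℚ.* ind (M′ ≟ˢ W ∪ V))))
                 (λ V → ∑-nonNeg (allFin (k ℕ.∸ 1)) (λ i → ∑-nonNeg (subsets N) (0≤term V i))) (∈-subsets V) ⟩
          supplements M′ ∎
          where
          open ℚ.≤-Reasoning
          V W : Subset N
          V = M′ ∩ M
          W = M′ ─ M
          i : Fin (k ℕ.∸ 1)
          i = fromℕ< j<k∸1
          units : ∀ a → a ≡ (1ℚ ℚ.* (1ℚ ℚ.* a)) ℚ.* 1ℚ
          units = solve 1 (λ a → a := (con 1ℚ :* (con 1ℚ :* a)) :* con 1ℚ) refl
            where open +-*-Solver
          0≤term : ∀ V i W → 0ℚ ℚ.≤ supplementTerm V i W ℚ.* ind (M′ ≟ˢ W ∪ V)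
          0≤term V i W = *-nonNeg (0≤supplementTerm V i W) (0≤ind (M′ ≟ˢ W ∪ V))
          isSupplement : Supplement 𝒜 (suc (toℕ i)) V W
          isSupplement = trans size (cong suc (sym (Fin.toℕ-fromℕ< j<k∸1)))
            , [p─q]∩[p∩q]≡⊥ M′ M
            , subst (Minterm 𝒜) (sym ([p─q]∪[p∩q]≡p M′ M)) isMin′

        -- Either M′ = M, or M′ ─ M is a supplement of M′ ∩ M of size < k, or ∣ M′ ─ M ∣ = k = ∣ M′ ∣.
        degreeTerm≤ : ∀ M′ → minterm M′ ℚ.* q ^ℚ ∣ M′ ─ M ∣ ℚ.≤
                      ind (M′ ≟ˢ M) ℚ.+ (minterm M′ ℚ.* q ^ℚ ∣ M′ ∣ ℚ.+ supplements M′)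
        degreeTerm≤ M′ = byMinterm (minterm? 𝒜 M′)
          where
          -- With `M′ ─ M` empty, `M′ ⊆ M`, and minimality of `M` excludes a proper inclusion.
          M′≡M : Minterm 𝒜 M′ → ∣ M′ ─ M ∣ ≡ 0 → M′ ≡ M
          M′≡M isMin′ size = p⊆q∧p⊄q⇒p≡q (∣p─q∣≡0⇒p⊆q M′ M size)
            (λ M′⊂M → proj₂ isMin M′ M′⊂M (proj₁ isMin′))
          k≤∣M′─M∣ : ∀ {m} → ¬ (m ℕ.≤ k ℕ.∸ 1) → k ℕ.≤ m
          k≤∣M′─M∣ m≰k∸1 = ℕ.≤-trans (ℕ.m≤n+m∸n k 1) (ℕ.≰⇒> m≰k∸1)
          -- The size is squeezed by `k ≤ m ≤ ∣ M′ ∣ ≤ k`, so the power of `q` is the summand of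
          -- `M′` in `firstMoment`.
          ∣M′─M∣≡∣M′∣ : Minterm 𝒜 M′ → ∀ {m} → ∣ M′ ─ M ∣ ≡ m → ¬ (m ℕ.≤ k ℕ.∸ 1) → m ≡ ∣ M′ ∣
          ∣M′─M∣≡∣M′∣ isMin′ size m≰k∸1 = ℕ.≤-antisym
            (subst (ℕ._≤ ∣ M′ ∣) size (∣p─q∣≤∣p∣ M′ M))
            (ℕ.≤-trans (small M′ isMin′) (k≤∣M′─M∣ m≰k∸1))
          bySize : Minterm 𝒜 M′ → ∀ m → ∣ M′ ─ M ∣ ≡ m → Dec (m ℕ.≤ k ℕ.∸ 1) →
                   q ^ℚ m ℚ.≤ ind (M′ ≟ˢ M) ℚ.+ (q ^ℚ ∣ M′ ∣ ℚ.+ supplements M′)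
          bySize isMin′ ℕ.zero size _ =
            ℚ.≤-trans (ℚ.≤-reflexive (sym (ind-true (M′ ≟ˢ M) (M′≡M isMin′ size))))
              (p≤p+q (ℚ.+-mono-≤ (^-nonNeg 0≤q ∣ M′ ∣) (0≤supplements M′)))
          bySize isMin′ (suc j) size (yes j<k∸1) =
            ℚ.≤-trans (^-≤supplements M′ isMin′ j size j<k∸1)
              (ℚ.≤-trans (q≤p+q (^-nonNeg 0≤q ∣ M′ ∣)) (q≤p+q (0≤ind (M′ ≟ˢ M))))
          bySize isMin′ (suc j) size (no j≮k∸1) =
            ℚ.≤-trans (ℚ.≤-reflexive (cong (q ^ℚ_) (∣M′─M∣≡∣M′∣ isMin′ size j≮k∸1)))
              (ℚ.≤-trans (p≤p+q (0≤supplements M′)) (q≤p+q (0≤ind (M′ ≟ˢ M))))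
          -- The decision `d` occurs on both sides of the inequality; abstracting it lets one case
          -- split reduce both.
          byMinterm : (d : Dec (Minterm 𝒜 M′)) → ind d ℚ.* q ^ℚ ∣ M′ ─ M ∣ ℚ.≤
                      ind (M′ ≟ˢ M) ℚ.+ (ind d ℚ.* q ^ℚ ∣ M′ ∣ ℚ.+ supplements M′)
          byMinterm (no _) = ℚ.≤-trans (ℚ.≤-reflexive (ℚ.*-zeroˡ (q ^ℚ ∣ M′ ─ M ∣)))
            (ℚ.+-mono-≤ (0≤ind (M′ ≟ˢ M)) (ℚ.+-mono-≤
              (ℚ.≤-reflexive (sym (ℚ.*-zeroˡ (q ^ℚ ∣ M′ ∣)))) (0≤supplements M′)))
          byMinterm (yes isMin′) = ℚ.≤-trans (ℚ.≤-reflexive (ℚ.*-identityˡ (q ^ℚ ∣ M′ ─ M ∣)))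
            (ℚ.≤-trans (bySize isMin′ ∣ M′ ─ M ∣ refl (∣ M′ ─ M ∣ ℕ.≤? k ℕ.∸ 1))
              (ℚ.+-monoʳ-≤ (ind (M′ ≟ˢ M)) (ℚ.+-monoˡ-≤ (supplements M′)
                (ℚ.≤-reflexive (sym (ℚ.*-identityˡ (q ^ℚ ∣ M′ ∣)))))))

        degree≤ : degree M ℚ.≤ 1ℚ ℚ.+ (firstMoment ℚ.+ ι (2 ℕ.^ ∣ M ∣ ℕ.* (k ℕ.∸ 1)))
        degree≤ = begin
          degree M
            ≤⟨ ∑-mono (subsets N) degreeTerm≤ ⟩
          ∑[ M′ ∈ subsets N ] (ind (M′ ≟ˢ M) ℚ.+ (minterm M′ ℚ.* q ^ℚ ∣ M′ ∣ ℚ.+ supplements M′))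
            ≡⟨ trans (∑-distrib-+ (subsets N) (λ M′ → ind (M′ ≟ˢ M)) _)
                 (cong₂ ℚ._+_ (∑-≡ M) (trans (∑-distrib-+ (subsets N) (λ M′ → minterm M′ ℚ.* q ^ℚ ∣ M′ ∣) supplements)
                   (cong (ℚ._+ ∑[ M′ ∈ subsets N ] supplements M′) (sym firstMoment≡)))) ⟩
          1ℚ ℚ.+ (firstMoment ℚ.+ ∑[ M′ ∈ subsets N ] supplements M′)
            ≤⟨ ℚ.+-monoʳ-≤ 1ℚ (ℚ.+-monoʳ-≤ firstMoment ∑-supplements≤) ⟩
          1ℚ ℚ.+ (firstMoment ℚ.+ ι (2 ℕ.^ ∣ M ∣ ℕ.* (k ℕ.∸ 1))) ∎
          where open ℚ.≤-Reasoning

-- The bound at a rational parameter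

open Moments using (firstMoment; measure)

-- Since `ℓ * E` equals the left side for both choices of `ℓ`, all that has to be checked is
-- `ℓ * (E + r) ≤ 1` with `r = K - 1`. If `E ≤ 1` then `E + r ≤ 1 + r = K`; if `1 ≤ E` then
-- `E + r ≤ E * (1 + r) = E * K`. Both need the degree bound `E + K - 1` rather than `E + K`.
[𝔼⊓1]/K≤measure : ∀ k .{{_ : NonZero k}} {N} (𝒜 : Family N) {q} → 0ℚ ℚ.≤ q → q ℚ.≤ 1ℚ →
  Monotone 𝒜 → MintermsOfSizeAtMost k 𝒜 → TameAt k q 𝒜 →
  (firstMoment 𝒜 q ℚ.⊓ 1ℚ) ℚ.* ℚ._/_ (+ 1) (k ℕ.* 2 ℕ.^ k) {{k*2^k≢0 k}} ℚ.≤ measure 𝒜 q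
[𝔼⊓1]/K≤measure k 𝒜 {q} 0≤q q≤1 mono small tame = bySize (ℚ.≤-total E 1ℚ)
  where
  open ℚ.≤-Reasoning
  instance
    K≢0 : NonZero (k ℕ.* 2 ℕ.^ k)
    K≢0 = k*2^k≢0 k
  K : ℕ
  K = k ℕ.* 2 ℕ.^ k
  E r c : ℚ
  E = firstMoment 𝒜 q
  r = ι (ℕ.pred K)
  c = + 1 ℚ./ K
  0≤c : 0ℚ ℚ.≤ c
  0≤c = ℚ.nonNegative⁻¹ c {{ℚ.normalize-nonNeg 1 K}}
  1+r≡K : 1ℚ ℚ.+ r ≡ ι K
  1+r≡K = trans (sym (ι-homo-+ 1 (ℕ.pred K))) (cong ι (ℕ.suc-pred K))
  rearrange : ∀ e z → 1ℚ ℚ.+ (e ℚ.+ z) ≡ e ℚ.+ (1ℚ ℚ.+ z)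
  rearrange = solve 2 (λ e z → con 1ℚ :+ (e :+ z) := e :+ (con 1ℚ :+ z)) refl
    where open +-*-Solver
  degree≤E+r : ∀ M → Minterm 𝒜 M → Moments.degree 𝒜 q M ℚ.≤ E ℚ.+ r
  degree≤E+r M isMin = begin
    Moments.degree 𝒜 q M        ≤⟨ Moments.degree≤ 𝒜 q 0≤q k small tame M isMin ⟩
    1ℚ ℚ.+ (E ℚ.+ ι z)          ≡⟨ rearrange E (ι z) ⟩
    E ℚ.+ (1ℚ ℚ.+ ι z)          ≡⟨ cong (E ℚ.+_) (ι-homo-+ 1 z) ⟨
    E ℚ.+ ι (suc z)             ≤⟨ ℚ.+-monoʳ-≤ E (ι-mono-≤ (ℕ.pred-mono-≤ (2+2^i*[k∸1]≤k*2^k k (small M isMin)))) ⟩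
    E ℚ.+ r                     ∎
    where
    z : ℕ
    z = 2 ℕ.^ ∣ M ∣ ℕ.* (k ℕ.∸ 1)
  ℓE≤measure : ∀ ℓ → 0ℚ ℚ.≤ ℓ → ℓ ℚ.* (E ℚ.+ r) ℚ.≤ 1ℚ → ℓ ℚ.* E ℚ.≤ measure 𝒜 q
  ℓE≤measure = Moments.ℓ*firstMoment≤measure 𝒜 q 0≤q q≤1 mono (E ℚ.+ r) degree≤E+r
  bySize : E ℚ.≤ 1ℚ ⊎ 1ℚ ℚ.≤ E → (E ℚ.⊓ 1ℚ) ℚ.* c ℚ.≤ measure 𝒜 q
  bySize (inj₁ E≤1) = begin
    (E ℚ.⊓ 1ℚ) ℚ.* c   ≡⟨ cong (ℚ._* c) (ℚ.p≤q⇒p⊓q≡p E≤1) ⟩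
    E ℚ.* c            ≡⟨ ℚ.*-comm E c ⟩
    c ℚ.* E            ≤⟨ ℓE≤measure c 0≤c c[E+r]≤1 ⟩
    measure 𝒜 q        ∎
    where
    c[E+r]≤1 : c ℚ.* (E ℚ.+ r) ℚ.≤ 1ℚ
    c[E+r]≤1 = begin
      c ℚ.* (E ℚ.+ r)    ≤⟨ *-monoˡ-≤ 0≤c (ℚ.+-monoˡ-≤ r E≤1) ⟩
      c ℚ.* (1ℚ ℚ.+ r)   ≡⟨ cong (c ℚ.*_) 1+r≡K ⟩
      c ℚ.* ι K          ≡⟨ 1/d*d≡1 K ⟩
      1ℚ                 ∎
  bySize (inj₂ 1≤E) = begin
    (E ℚ.⊓ 1ℚ) ℚ.* c         ≡⟨ cong (ℚ._* c) (ℚ.p≥q⇒p⊓q≡q 1≤E) ⟩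
    1ℚ ℚ.* c                 ≡⟨ cong (ℚ._* c) (recip-inverse E 0<E) ⟨
    (E ℚ.* recip E) ℚ.* c    ≡⟨ rotate E (recip E) c ⟩
    (recip E ℚ.* c) ℚ.* E    ≤⟨ ℓE≤measure (recip E ℚ.* c) (*-nonNeg 0≤1/E 0≤c) c[E+r]/E≤1 ⟩
    measure 𝒜 q              ∎
    where
    0<E : 0ℚ ℚ.< E
    0<E = ℚ.<-≤-trans (ℚ.positive⁻¹ 1ℚ) 1≤E
    0≤1/E : 0ℚ ℚ.≤ recip E
    0≤1/E = ℚ.*-cancelˡ-≤-pos E {{ℚ.positive 0<E}} (begin
      E ℚ.* 0ℚ        ≡⟨ ℚ.*-zeroʳ E ⟩
      0ℚ              ≤⟨ ℚ.nonNegative⁻¹ 1ℚ ⟩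
      1ℚ              ≡⟨ recip-inverse E 0<E ⟨
      E ℚ.* recip E   ∎)
    rotate : ∀ a b c → (a ℚ.* b) ℚ.* c ≡ (b ℚ.* c) ℚ.* a
    rotate = solve 3 (λ a b c → (a :* b) :* c := (b :* c) :* a) refl
      where open +-*-Solver
    regroup : ∀ a b c d → (b ℚ.* c) ℚ.* (a ℚ.* d) ≡ (a ℚ.* b) ℚ.* (c ℚ.* d)
    regroup = solve 4 (λ a b c d → (b :* c) :* (a :* d) := (a :* b) :* (c :* d)) refl
      where open +-*-Solver
    E+r≤EK : E ℚ.+ r ℚ.≤ E ℚ.* ι K
    E+r≤EK = begin
      E ℚ.+ r                    ≡⟨ cong₂ ℚ._+_ (ℚ.*-identityʳ E) (ℚ.*-identityˡ r) ⟨
      E ℚ.* 1ℚ ℚ.+ 1ℚ ℚ.* r      ≤⟨ ℚ.+-monoʳ-≤ (E ℚ.* 1ℚ) (*-monoʳ-≤ (0≤ι (ℕ.pred K)) 1≤E) ⟩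
      E ℚ.* 1ℚ ℚ.+ E ℚ.* r       ≡⟨ ℚ.*-distribˡ-+ E 1ℚ r ⟨
      E ℚ.* (1ℚ ℚ.+ r)           ≡⟨ cong (E ℚ.*_) 1+r≡K ⟩
      E ℚ.* ι K                  ∎
    c[E+r]/E≤1 : (recip E ℚ.* c) ℚ.* (E ℚ.+ r) ℚ.≤ 1ℚ
    c[E+r]/E≤1 = begin
      (recip E ℚ.* c) ℚ.* (E ℚ.+ r)       ≤⟨ *-monoˡ-≤ (*-nonNeg 0≤1/E 0≤c) E+r≤EK ⟩
      (recip E ℚ.* c) ℚ.* (E ℚ.* ι K)     ≡⟨ regroup E (recip E) c (ι K) ⟩
      (E ℚ.* recip E) ℚ.* (c ℚ.* ι K)     ≡⟨ cong₂ ℚ._*_ (recip-inverse E 0<E) (1/d*d≡1 K) ⟩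
      1ℚ                                  ∎

-- Termwise computation of the real quantities

seq-^ : ∀ x m n → seq (x ^ m) n ≡ seq x n ^ℚ m
seq-^ x ℕ.zero  n = refl
seq-^ x (suc m) n = cong (seq x n ℚ.*_) (seq-^ x m n)

seq-∑ : ∀ (xs : List A) (f : A → ℝ) n → seq (∑ (map f xs)) n ≡ ∑[ x ∈ xs ] seq (f x) n
seq-∑ []       f n = refl
seq-∑ (x ∷ xs) f n = cong (seq (f x) n ℚ.+_) (seq-∑ xs f n)

seq-weight : ∀ {N} p (S : Subset N) n → seq (weight p S) n ≡ weightℚ (seq p n) S
seq-weight p []            n = refl
seq-weight p (inside  ∷ S) n = cong (seq p n ℚ.*_) (seq-weight p S n)
seq-weight p (outside ∷ S) n = cong ((1ℚ ℚ.- seq p n) ℚ.*_) (seq-weight p S n)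

seq-μ : ∀ {N} p (𝒜 : Family N) n → seq (μ p 𝒜) n ≡ measure 𝒜 (seq p n)
seq-μ {N} p 𝒜 n = begin
  seq (μ p 𝒜) n                                                    ≡⟨ seq-∑ members (weight p) n ⟩
  ∑[ S ∈ members ] seq (weight p S) n                              ≡⟨ ∑-cong members (λ S → seq-weight p S n) ⟩
  ∑[ S ∈ members ] weightℚ (seq p n) S                             ≡⟨ ∑-filter (λ S → T? (𝒜 S)) (subsets N) (weightℚ (seq p n)) ⟩
  measure 𝒜 (seq p n)                                              ∎
  where
  open ≡-Reasoning
  members : List (Subset N)
  members = filter (λ S → T? (𝒜 S)) (subsets N)

seq-X : ∀ {N} (𝒜 : Family N) q S n → seq (X 𝒜 S) n ≡ Moments.mintermsIn 𝒜 q S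
seq-X {N} 𝒜 q S n = trans (#≡∑ind (λ M → minterm? 𝒜 M ×-dec M ⊆? S))
  (∑-cong (subsets N) (λ M → ind-× (minterm? 𝒜 M) (M ⊆? S)))

seq-𝔼X : ∀ {N} p (𝒜 : Family N) n → seq (𝔼 p (X 𝒜)) n ≡ firstMoment 𝒜 (seq p n)
seq-𝔼X {N} p 𝒜 n = trans (seq-∑ (subsets N) (λ S → weight p S * X 𝒜 S) n)
  (∑-cong (subsets N) (λ S → cong₂ ℚ._*_ (seq-weight p S n) (seq-X 𝒜 (seq p n) S n)))

-- Termwise operations respect equality of reals

infix 4 _≈_

_≈_ : ℝ → ℝ → Set
x ≈ y = ∀ ε → 0ℚ ℚ.< ε → ∃[ N ] (∀ n → N ℕ.≤ n → ℚ.∣ seq x n ℚ.- seq y n ∣ ℚ.< ε)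

-- The sequence `f 0, g 0, f 1, g 1, ...`; the two arguments trade places at each step, so no parity
-- test is needed.
interleave : (ℕ → A) → (ℕ → A) → ℕ → A
interleave f g ℕ.zero  = f 0
interleave f g (suc n) = interleave g (f ∘ suc) n

interleave-even : ∀ (f g : ℕ → A) n → interleave f g (n ℕ.* 2) ≡ f n
interleave-even f g ℕ.zero  = refl
interleave-even f g (suc n) = interleave-even (f ∘ suc) (g ∘ suc) n

interleave-odd : ∀ (f g : ℕ → A) n → interleave f g (suc (n ℕ.* 2)) ≡ g n
interleave-odd f g n = interleave-even g (f ∘ suc) n

-- Position `N * 2` holds `f N`, so the threshold doubles. Applied to each index in turn, this
-- reduces a claim about two positions of the interleaving to the four combinations of the original
-- sequences.
interleave-all : ∀ (P : A → Set) N {f g : ℕ → A} → (∀ i → N ℕ.≤ i → P (f i)) → (∀ i → N ℕ.≤ i → P (g i)) →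
                 ∀ n → N ℕ.* 2 ℕ.≤ n → P (interleave f g n)
interleave-all P ℕ.zero  Pf Pg ℕ.zero        _ = Pf 0 ℕ.z≤n
interleave-all P ℕ.zero  Pf Pg (suc n)       _ =
  interleave-all P ℕ.zero Pg (λ i _ → Pf (suc i) ℕ.z≤n) n ℕ.z≤n
interleave-all P (suc N) Pf Pg (suc (suc n)) (ℕ.s≤s (ℕ.s≤s N≤n)) =
  interleave-all P N (λ i N≤i → Pf (suc i) (ℕ.s≤s N≤i)) (λ i N≤i → Pg (suc i) (ℕ.s≤s N≤i)) n N≤n

interleave-cauchy : ∀ x y → x ≈ y → IsCauchy (interleave (seq x) (seq y))
interleave-cauchy x y x≈y ε 0<ε = N ℕ.* 2 , λ m n N≤m N≤n →
    interleave-all (λ a → ℚ.∣ a ℚ.- z n ∣ ℚ.< ε) N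
      (λ i N≤i → interleave-all (λ b → ℚ.∣ seq x i ℚ.- b ∣ ℚ.< ε) N
        (λ j N≤j → xx i j N≤i N≤j) (λ j N≤j → xy i j N≤i N≤j) n N≤n)
      (λ i N≤i → interleave-all (λ b → ℚ.∣ seq y i ℚ.- b ∣ ℚ.< ε) N
        (λ j N≤j → subst (ℚ._< ε) (∣-∣-comm (seq x j) (seq y i)) (xy j i N≤j N≤i))
        (λ j N≤j → yy i j N≤i N≤j) n N≤n)
      m N≤m
  where
  open ℚ.≤-Reasoning
  z : ℕ → ℚ
  z = interleave (seq x) (seq y)
  ε/2 : ℚ
  ε/2 = ε ℚ.* ℚ.½
  xHalf = cauchy x ε/2 (half-pos 0<ε)
  xFull = cauchy x ε 0<ε
  yFull = cauchy y ε 0<ε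
  xyHalf = x≈y ε/2 (half-pos 0<ε)
  N₁ N₂ N₃ N₄ N : ℕ
  N₁ = proj₁ xHalf
  N₂ = proj₁ xFull
  N₃ = proj₁ yFull
  N₄ = proj₁ xyHalf
  N = (N₁ ℕ.⊔ N₂) ℕ.⊔ (N₃ ℕ.⊔ N₄)
  N₁₂≤ : ∀ {i} → N ℕ.≤ i → N₁ ℕ.⊔ N₂ ℕ.≤ i
  N₁₂≤ = ℕ.m⊔n≤o⇒m≤o (N₁ ℕ.⊔ N₂) (N₃ ℕ.⊔ N₄)
  N₃₄≤ : ∀ {i} → N ℕ.≤ i → N₃ ℕ.⊔ N₄ ℕ.≤ i
  N₃₄≤ = ℕ.m⊔n≤o⇒n≤o (N₁ ℕ.⊔ N₂) (N₃ ℕ.⊔ N₄)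
  xx : ∀ i j → N ℕ.≤ i → N ℕ.≤ j → ℚ.∣ seq x i ℚ.- seq x j ∣ ℚ.< ε
  xx i j N≤i N≤j = proj₂ xFull i j (ℕ.m⊔n≤o⇒n≤o N₁ N₂ (N₁₂≤ N≤i)) (ℕ.m⊔n≤o⇒n≤o N₁ N₂ (N₁₂≤ N≤j))
  yy : ∀ i j → N ℕ.≤ i → N ℕ.≤ j → ℚ.∣ seq y i ℚ.- seq y j ∣ ℚ.< ε
  yy i j N≤i N≤j = proj₂ yFull i j (ℕ.m⊔n≤o⇒m≤o N₃ N₄ (N₃₄≤ N≤i)) (ℕ.m⊔n≤o⇒m≤o N₃ N₄ (N₃₄≤ N≤j))
  -- The mixed case passes through `seq x j`, hence the two thresholds at `ε / 2`.
  xy : ∀ i j → N ℕ.≤ i → N ℕ.≤ j → ℚ.∣ seq x i ℚ.- seq y j ∣ ℚ.< ε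
  xy i j N≤i N≤j = begin-strict
    ℚ.∣ seq x i ℚ.- seq y j ∣
      ≡⟨ cong ℚ.∣_∣ (telescope (seq x i) (seq x j) (seq y j)) ⟩
    ℚ.∣ (seq x i ℚ.- seq x j) ℚ.+ (seq x j ℚ.- seq y j) ∣
      ≤⟨ ℚ.∣p+q∣≤∣p∣+∣q∣ (seq x i ℚ.- seq x j) (seq x j ℚ.- seq y j) ⟩
    ℚ.∣ seq x i ℚ.- seq x j ∣ ℚ.+ ℚ.∣ seq x j ℚ.- seq y j ∣
      <⟨ ℚ.+-mono-<
           (proj₂ xHalf i j (ℕ.m⊔n≤o⇒m≤o N₁ N₂ (N₁₂≤ N≤i)) (ℕ.m⊔n≤o⇒m≤o N₁ N₂ (N₁₂≤ N≤j)))
           (proj₂ xyHalf j (ℕ.m⊔n≤o⇒n≤o N₃ N₄ (N₃₄≤ N≤j))) ⟩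
    ε/2 ℚ.+ ε/2
      ≡⟨ half-sum ε ⟩
    ε ∎

-- A termwise function maps the interleaving of x and y to the interleaving of its values at x
-- and y; that the latter is Cauchy is the continuity statement.
termwise-≈ : ∀ (h : ℝ → ℝ) (H : ℚ → ℚ) → (∀ x n → seq (h x) n ≡ H (seq x n)) →
             ∀ x y → x ≈ y → h x ≈ h y
termwise-≈ h H seq-h x y x≈y ε 0<ε = N , λ n N≤n →
    subst (ℚ._< ε) (cong ℚ.∣_∣ (cong₂ ℚ._-_
        (trans (seq-h z (n ℕ.* 2)) (trans (cong H (interleave-even (seq x) (seq y) n)) (sym (seq-h x n))))
        (trans (seq-h z (suc (n ℕ.* 2))) (trans (cong H (interleave-odd (seq x) (seq y) n)) (sym (seq-h y n))))))
      -- The neighbouring positions `2n` and `2n + 1` carry the `n`th terms of `x` and of `y`, so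
      -- the Cauchy property of `h z` compares `h x` with `h y`.
      (close (n ℕ.* 2) (suc (n ℕ.* 2)) (N≤2n N≤n) (ℕ.m≤n⇒m≤1+n (N≤2n N≤n)))
  where
  z : ℝ
  z = mkℝ (interleave (seq x) (seq y)) (interleave-cauchy x y x≈y)
  N : ℕ
  N = proj₁ (cauchy (h z) ε 0<ε)
  close = proj₂ (cauchy (h z) ε 0<ε)
  N≤2n : ∀ {n} → N ℕ.≤ n → N ℕ.≤ n ℕ.* 2
  N≤2n {n} N≤n = ℕ.≤-trans N≤n (ℕ.m≤m*n n 2)

x≤1⇒x≈x⊓1 : ∀ x → x ≤ 1ℝ → x ≈ x ⊓ 1ℝ
x≤1⇒x≈x⊓1 x x≤1 ε 0<ε with x≤1 (ε ℚ.* ℚ.½) (half-pos 0<ε)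
-- Half of `ε` is requested because `_≤_` gives a non-strict bound while `_≈_` asks for a strict
-- one.
... | N , bound = N , λ n N≤n → ∣p∣<ε
    (<⇒minus< (upper (seq x n) (bound n N≤n)))
    (subst (ℚ._< ε) (sym (neg-minus (seq x n) (seq x n ℚ.⊓ 1ℚ)))
      (<⇒minus< (ℚ.≤-<-trans (ℚ.p⊓q≤p (seq x n) 1ℚ) (p<p+ε (seq x n)))))
  where
  p<p+ε : ∀ p → p ℚ.< p ℚ.+ ε
  p<p+ε p = subst (ℚ._< p ℚ.+ ε) (ℚ.+-identityʳ p) (ℚ.+-monoʳ-< p 0<ε)
  ε/2<ε : ε ℚ.* ℚ.½ ℚ.< ε
  ε/2<ε = subst (ε ℚ.* ℚ.½ ℚ.<_) (half-sum ε)
    (subst (ℚ._< ε ℚ.* ℚ.½ ℚ.+ ε ℚ.* ℚ.½) (ℚ.+-identityʳ (ε ℚ.* ℚ.½)) (ℚ.+-monoʳ-< (ε ℚ.* ℚ.½) (half-pos 0<ε)))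
  upper : ∀ p → p ℚ.≤ 1ℚ ℚ.+ ε ℚ.* ℚ.½ → p ℚ.< (p ℚ.⊓ 1ℚ) ℚ.+ ε
  upper p p≤ with ℚ.⊓-sel p 1ℚ
  ... | inj₁ eq = subst (λ t → p ℚ.< t ℚ.+ ε) (sym eq) (p<p+ε p)
  ... | inj₂ eq = subst (λ t → p ℚ.< t ℚ.+ ε) (sym eq) (ℚ.≤-<-trans p≤ (ℚ.+-monoʳ-< 1ℚ ε/2<ε))

-- From hypotheses on the real parameter to its terms

Eventually : (ℕ → Set) → Set
Eventually P = ∃[ N ] (∀ n → N ℕ.≤ n → P n)

eventually-∈ : ∀ (xs : List A) {P : A → ℕ → Set} → (∀ x → Eventually (P x)) →
               Eventually (λ n → ∀ x → x ∈ xs → P x n)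
eventually-∈ []       ev = 0 , λ _ _ _ ()
eventually-∈ (x ∷ xs) ev with ev x | eventually-∈ xs ev
... | N₁ , P₁ | N₂ , P₂ = N₁ ℕ.⊔ N₂ , λ where
  n N≤n _ (here refl)  → P₁ n (ℕ.m⊔n≤o⇒m≤o N₁ N₂ N≤n)
  n N≤n y (there y∈xs) → P₂ n (ℕ.m⊔n≤o⇒n≤o N₁ N₂ N≤n) y y∈xs

eventually-pos : ∀ p → 0ℝ < p → Eventually (λ n → 0ℚ ℚ.< seq p n)
eventually-pos p (δ , 0<δ , N , δ≤p) = N , λ n N≤n →
  ℚ.<-≤-trans 0<δ (subst (ℚ._≤ seq p n) (ℚ.+-identityˡ δ) (δ≤p n N≤n))

-- A strict real inequality comes with a positive rational gap valid from some index on; dropping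
-- the gap leaves the inequality between terms.
eventually-≤recip^ : ∀ c p (0<p : 0ℝ < p) m → fromℕ c < inv p 0<p ^ m →
                     Eventually (λ n → ι c ℚ.≤ recip (seq p n) ^ℚ m)
eventually-≤recip^ c p 0<p m (ε , 0<ε , N , c+ε≤) = N , λ n N≤n →
  ℚ.≤-trans (p≤p+q (ℚ.<⇒≤ 0<ε))
            (subst (ι c ℚ.+ ε ℚ.≤_) (seq-^ (inv p 0<p) m n) (c+ε≤ n N≤n))

-- Capping `q` at 1 can only decrease its powers, so tameness survives the cap, and uncapped the
-- product is at most `(q * recip q) ^ m = 1`.
c≤recip^⇒c*[q⊓1]^≤1 : ∀ c q m → 0ℚ ℚ.< q → ι c ℚ.≤ recip q ^ℚ m → ι c ℚ.* (q ℚ.⊓ 1ℚ) ^ℚ m ℚ.≤ 1ℚ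
c≤recip^⇒c*[q⊓1]^≤1 c q m 0<q c≤ = begin
  ι c ℚ.* (q ℚ.⊓ 1ℚ) ^ℚ m    ≤⟨ *-monoˡ-≤ (0≤ι c) (^-monoˡ-≤ (ℚ.⊓-glb (ℚ.<⇒≤ 0<q) (ℚ.nonNegative⁻¹ 1ℚ))
                                                              (ℚ.p⊓q≤p q 1ℚ) m) ⟩
  ι c ℚ.* q ^ℚ m             ≤⟨ *-monoʳ-≤ (^-nonNeg (ℚ.<⇒≤ 0<q) m) c≤ ⟩
  recip q ^ℚ m ℚ.* q ^ℚ m    ≡⟨ ℚ.*-comm (recip q ^ℚ m) (q ^ℚ m) ⟩
  q ^ℚ m ℚ.* recip q ^ℚ m    ≡⟨ ^-distrib-* q (recip q) m ⟨
  (q ℚ.* recip q) ^ℚ m       ≡⟨ cong (_^ℚ m) (recip-inverse q 0<q) ⟩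
  1ℚ ^ℚ m                    ≡⟨ 1^m≡1 m ⟩
  1ℚ                         ∎
  where open ℚ.≤-Reasoning

eventually-tame : ∀ {N} k p (0<p : 0ℝ < p) (𝒜 : Family N) → Tame k p 0<p 𝒜 →
                  Eventually (λ n → 0ℚ ℚ.< seq p n × TameAt k (seq p n ℚ.⊓ 1ℚ) 𝒜)
eventually-tame {N} k p 0<p 𝒜 tame = N₁ ℕ.⊔ N₂ , λ n N≤n → both n
    (pos n (ℕ.m⊔n≤o⇒m≤o N₁ N₂ N≤n)) (bounds n (ℕ.m⊔n≤o⇒n≤o N₁ N₂ N≤n))
  where
  count : Fin (k ℕ.∸ 1) → Subset N → ℕ
  count i V = # supplement? 𝒜 (suc (toℕ i)) V
  Bound : Fin (k ℕ.∸ 1) → Subset N → ℕ → Set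
  Bound i V n = ι (count i V) ℚ.≤ recip (seq p n) ^ℚ suc (toℕ i)
  Bounds : ℕ → Set
  Bounds n = ∀ i → i ∈ allFin (k ℕ.∸ 1) → ∀ V → V ∈ subsets N → Bound i V n
  evBounds : Eventually Bounds
  -- The threshold given by `tame` depends on `i` and `V`; as both range over finite lists, a
  -- maximum works for all.
  evBounds = eventually-∈ (allFin (k ℕ.∸ 1)) (λ i → eventually-∈ (subsets N) {Bound i} (λ V →
    eventually-≤recip^ (count i V) p 0<p (suc (toℕ i)) (tame (suc (toℕ i)) (ℕ.s≤s ℕ.z≤n) (Fin.toℕ<n i) V)))
  both : ∀ n → 0ℚ ℚ.< seq p n → Bounds n → 0ℚ ℚ.< seq p n × TameAt k (seq p n ℚ.⊓ 1ℚ) 𝒜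
  both n 0<q bs = 0<q , λ i V →
    c≤recip^⇒c*[q⊓1]^≤1 (count i V) (seq p n) (suc (toℕ i)) 0<q (bs i (∈-allFin i) V (∈-subsets V))
  N₁ N₂ : ℕ
  N₁ = proj₁ (eventually-pos p 0<p)
  N₂ = proj₁ evBounds
  pos : ∀ n → N₁ ℕ.≤ n → 0ℚ ℚ.< seq p n
  pos = proj₂ (eventually-pos p 0<p)
  bounds : ∀ n → N₂ ℕ.≤ n → Bounds n
  bounds = proj₂ evBounds

lemma4p1 : (k : ℕ) .{{_ : NonZero k}} (n : ℕ) (p : ℝ) (0<p : 0ℝ < p) → p ≤ 1ℝ →
    (𝒜 : Family (suc n)) → Monotone 𝒜 → MintermsOfSizeAtMost k 𝒜 → Tame k p 0<p 𝒜 →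
    _/ℕ_ (𝔼 p (X 𝒜) ⊓ 1ℝ) (k ℕ.* 2 ℕ.^ k) {{k*2^k≢0 k}} ≤ μ p 𝒜
lemma4p1 k n p 0<p p≤1 𝒜 mono small tame ε 0<ε = N₁ ℕ.⊔ N₂ , λ i N≤i →
    ℚ.<⇒≤ (minus<⇒< (begin-strict
      seq (gap p) i                                          ≡⟨ p≡q+[p-q] (seq (gap p) i) (seq (gap p′) i) ⟩
      seq (gap p′) i ℚ.+ (seq (gap p) i ℚ.- seq (gap p′) i)  ≤⟨ ℚ.+-mono-≤ (gap′≤0 i (ℕ.m⊔n≤o⇒n≤o N₁ N₂ N≤i))
                                                                  (p≤∣p∣ (seq (gap p) i ℚ.- seq (gap p′) i)) ⟩
      0ℚ ℚ.+ ℚ.∣ seq (gap p) i ℚ.- seq (gap p′) i ∣          <⟨ ℚ.+-monoʳ-< 0ℚ (close i (ℕ.m⊔n≤o⇒m≤o N₁ N₂ N≤i)) ⟩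
      0ℚ ℚ.+ ε                                               ≡⟨ ℚ.+-identityˡ ε ⟩
      ε                                                      ∎))
  where
  open ℚ.≤-Reasoning
  K : ℕ
  K = k ℕ.* 2 ℕ.^ k
  -- The terms of p may exceed 1, where weights are negative.
  p′ : ℝ
  p′ = p ⊓ 1ℝ
  -- Taking the difference of the two sides as a single function of the parameter makes one appeal
  -- to continuity enough: `gap p′` is eventually at most 0 termwise, and `gap p` is eventually
  -- within `ε` of it.
  gap : ℝ → ℝ
  gap x = _/ℕ_ (𝔼 x (X 𝒜) ⊓ 1ℝ) K {{k*2^k≢0 k}} - μ x 𝒜
  gapℚ : ℚ → ℚ
  gapℚ q = (firstMoment 𝒜 q ℚ.⊓ 1ℚ) ℚ.* ℚ._/_ (+ 1) K {{k*2^k≢0 k}} ℚ.- measure 𝒜 q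
  seq-gap : ∀ x i → seq (gap x) i ≡ gapℚ (seq x i)
  seq-gap x i = cong₂ (λ e m → (e ℚ.⊓ 1ℚ) ℚ.* ℚ._/_ (+ 1) K {{k*2^k≢0 k}} ℚ.- m) (seq-𝔼X x 𝒜 i) (seq-μ x 𝒜 i)
  gap≈gap′ = termwise-≈ gap gapℚ seq-gap p p′ (x≤1⇒x≈x⊓1 p p≤1) ε 0<ε
  evTame = eventually-tame k p 0<p 𝒜 tame
  N₁ N₂ : ℕ
  N₁ = proj₁ gap≈gap′
  N₂ = proj₁ evTame
  close = proj₂ gap≈gap′
  gap′≤0 : ∀ i → N₂ ℕ.≤ i → seq (gap p′) i ℚ.≤ 0ℚ
  gap′≤0 i N₂≤i = begin
    seq (gap p′) i                                       ≡⟨ seq-gap p′ i ⟩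
    gapℚ q                                               ≤⟨ ℚ.+-monoˡ-≤ (ℚ.- measure 𝒜 q) bound ⟩
    measure 𝒜 q ℚ.- measure 𝒜 q                          ≡⟨ ℚ.+-inverseʳ (measure 𝒜 q) ⟩
    0ℚ                                                   ∎
    where
    q : ℚ
    q = seq p i ℚ.⊓ 1ℚ
    bound = [𝔼⊓1]/K≤measure k 𝒜
      (ℚ.⊓-glb (ℚ.<⇒≤ (proj₁ (proj₂ evTame i N₂≤i))) (ℚ.nonNegative⁻¹ 1ℚ)) (ℚ.p⊓q≤q (seq p i) 1ℚ)
      mono small (proj₂ (proj₂ evTame i N₂≤i))
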